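{- For every integer $\ell>0$ there is a polynomial-time reduction that, given a monotone circuit $C$ of depth $\ell$, produces samples $\{(\mathbf{x}_i,y_i)\}_{i\in[m]}$ with $\mathbf{x}_i\in\mathbb{R}^n$, $y_i\in\mathbb{R}$, such that $$\min_{\mathbf{w}\in\mathbb{R}^n}\sum_{i=1}^m\big([\langle\mathbf{w},\mathbf{x}_i\rangle]_+-y_i\big)^2=\frac{\mathrm{opt}(C)}{(10|C|)^{2\ell+2}}.$$
   Context: $[z]_+:=\max(0,z)$. A monotone circuit is a Boolean circuit in which every gate is an OR gate or an AND gate (of arbitrary fan-in); $|C|$ denotes the number of wires of $C$. For a monotone circuit $C$, $\mathrm{opt}(C)$ is the minimum number of input wires that must be set to True so that the output wire of $C$ evaluates to True (the Minimum Monotone Circuit Satisfiability optimum). The minimum is over single ReLUs with coefficient $+1$ and zero bias. -}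

module Defs where

open import Data.Bool.Base using (Bool; true; false; if_then_else_)
import Data.Bool.Properties as Bool
open import Data.Fin.Base using (Fin; zero; suc)
open import Data.Fin.Properties using (nonZeroIndex)
open import Data.Fin.Subset using (Subset; _∩_; ∣_∣; ⁅_⁆; Nonempty; ⊤)
open import Data.Fin.Subset.Properties
  using (_⊆?_; nonempty?; anySubset?; x∈p∩q⁺; ⊆⊤; ∈⊤)
open import Data.Integer.Base as ℤ using (ℤ)
open import Data.List.Base as List using (List; []; _∷_; _++_)
open import Data.Maybe.Base using (Maybe)
open import Data.Nat.Base as ℕ using (ℕ; zero; suc)
import Data.Nat.Properties as ℕ
open import Data.Nat.Binary.Base as ℕᵇ using (ℕᵇ; 2[1+_]; 1+[2_])
open import Data.Product.Base as Product using (∃; ∃₂; _×_; _,_; proj₁; proj₂)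
open import Data.Rational.Base as ℚ using (ℚ; 0ℚ; 1ℚ; ½)
import Data.Rational.Properties as ℚ
open import Data.Rational.Solver using (module +-*-Solver)
open import Data.Sign.Base using (Sign)
open import Data.Sum.Base using (inj₁; inj₂)
open import Data.Vec.Base as Vec using (Vec; []; _∷_; lookup; _[_]%=_)
open import Function.Base using (_∘_; case_of_)
open import Relation.Binary.PropositionalEquality
open import Relation.Nullary.Decidable using (yes; no; does; dec-true; _×-dec_)
open import Relation.Unary using (Decidable)

------------------------------------------------------------------------
-- Real numbers: Cauchy sequences of rationals with a modulus

IsCauchy : (ℕ → ℚ) → Set
IsCauchy x = ∀ ε → 0ℚ ℚ.< ε →
  ∃ λ N → ∀ m n → N ℕ.≤ m → N ℕ.≤ n → ℚ.∣ x m ℚ.- x n ∣ ℚ.< ε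

record ℝ : Set where
  constructor mkℝ
  field
    seq    : ℕ → ℚ
    cauchy : IsCauchy seq

open ℝ public

infix 4 _≃_ _≤ℝ_

_≃_ : ℝ → ℝ → Set
x ≃ y = ∀ ε → 0ℚ ℚ.< ε →
  ∃ λ N → ∀ n → N ℕ.≤ n → ℚ.∣ seq x n ℚ.- seq y n ∣ ℚ.< ε

_≤ℝ_ : ℝ → ℝ → Set
x ≤ℝ y = ∀ ε → 0ℚ ℚ.< ε →
  ∃ λ N → ∀ n → N ℕ.≤ n → seq x n ℚ.≤ seq y n ℚ.+ ε

private
  open +-*-Solver using (solve; _:=_; _:+_; _:*_; _:-_; :-_)

  half : ∀ {ε} → 0ℚ ℚ.< ε → 0ℚ ℚ.< ½ ℚ.* ε
  half = ℚ.*-monoʳ-<-pos ½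

  half+half : ∀ ε → ½ ℚ.* ε ℚ.+ ½ ℚ.* ε ≡ ε
  half+half ε = trans (sym (ℚ.*-distribʳ-+ ε ½ ½)) (ℚ.*-identityˡ ε)

  ∣-∣-≤ : ∀ {a b d} → a ℚ.≤ b ℚ.+ d → b ℚ.≤ a ℚ.+ d → ℚ.∣ a ℚ.- b ∣ ℚ.≤ d
  ∣-∣-≤ {a} {b} {d} p q with ℚ.∣p∣≡p∨∣p∣≡-p (a ℚ.- b)
  ... | inj₁ e = subst₂ ℚ._≤_ (sym e)
        (solve 2 (λ b d → (b :+ d) :- b := d) refl b d)
        (ℚ.+-monoˡ-≤ (ℚ.- b) p)
  ... | inj₂ e = subst₂ ℚ._≤_
        (trans (solve 2 (λ a b → b :- a := :- (a :- b)) refl a b) (sym e))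
        (solve 2 (λ a d → (a :+ d) :- a := d) refl a d)
        (ℚ.+-monoˡ-≤ (ℚ.- a) q)

  p≤∣p∣ : ∀ p → p ℚ.≤ ℚ.∣ p ∣
  p≤∣p∣ p with ℚ.≤-total 0ℚ p
  ... | inj₁ 0≤p = ℚ.≤-reflexive (sym (ℚ.0≤p⇒∣p∣≡p 0≤p))
  ... | inj₂ p≤0 = ℚ.≤-trans p≤0 (ℚ.0≤∣p∣ p)

  p≤q+∣p-q∣ : ∀ p q → p ℚ.≤ q ℚ.+ ℚ.∣ p ℚ.- q ∣
  p≤q+∣p-q∣ p q = subst (ℚ._≤ q ℚ.+ ℚ.∣ p ℚ.- q ∣)
    (solve 2 (λ p q → q :+ (p :- q) := p) refl p q)
    (ℚ.+-monoʳ-≤ q (p≤∣p∣ (p ℚ.- q)))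

  ∣p-q∣-sym : ∀ p q → ℚ.∣ p ℚ.- q ∣ ≡ ℚ.∣ q ℚ.- p ∣
  ∣p-q∣-sym p q = trans (sym (ℚ.∣-p∣≡∣p∣ (p ℚ.- q)))
    (cong ℚ.∣_∣ (solve 2 (λ p q → :- (p :- q) := q :- p) refl p q))

  ⊔0-bound : ∀ p q → (p ℚ.⊔ 0ℚ) ℚ.≤ (q ℚ.⊔ 0ℚ) ℚ.+ ℚ.∣ p ℚ.- q ∣
  ⊔0-bound p q = ℚ.⊔-lub
    (ℚ.≤-trans (p≤q+∣p-q∣ p q) (ℚ.+-monoˡ-≤ _ (ℚ.p≤p⊔q q 0ℚ)))
    (ℚ.+-mono-≤ (ℚ.p≤q⊔p q 0ℚ) (ℚ.0≤∣p∣ (p ℚ.- q)))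

  ∣⊔0-⊔0∣≤ : ∀ p q → ℚ.∣ (p ℚ.⊔ 0ℚ) ℚ.- (q ℚ.⊔ 0ℚ) ∣ ℚ.≤ ℚ.∣ p ℚ.- q ∣
  ∣⊔0-⊔0∣≤ p q = ∣-∣-≤ (⊔0-bound p q)
    (subst (λ d → (q ℚ.⊔ 0ℚ) ℚ.≤ (p ℚ.⊔ 0ℚ) ℚ.+ d) (∣p-q∣-sym q p) (⊔0-bound q p))

  const-cauchy′ : ∀ q → IsCauchy (λ _ → q)
  const-cauchy′ q ε 0<ε = 0 , λ _ _ _ _ →
    subst (ℚ._< ε) (cong ℚ.∣_∣ (sym (ℚ.+-inverseʳ q))) 0<ε

  neg-cauchy′ : ∀ x → IsCauchy x → IsCauchy (λ n → ℚ.- x n)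
  neg-cauchy′ x cx ε 0<ε with cx ε 0<ε
  ... | N , h = N , λ m n N≤m N≤n → subst (ℚ._< ε)
    (trans (∣p-q∣-sym (x m) (x n))
      (cong ℚ.∣_∣ (solve 2 (λ a b → b :- a := (:- a) :- (:- b)) refl (x m) (x n))))
    (h m n N≤m N≤n)

  +-cauchy′ : ∀ x y → IsCauchy x → IsCauchy y → IsCauchy (λ n → x n ℚ.+ y n)
  +-cauchy′ x y cx cy ε 0<ε
    with M , h ← cx (½ ℚ.* ε) (half 0<ε)
       | N , k ← cy (½ ℚ.* ε) (half 0<ε) = M ℕ.⊔ N , λ m n p q →
    let p₁ = ℕ.≤-trans (ℕ.m≤m⊔n M N) p ; p₂ = ℕ.≤-trans (ℕ.m≤n⊔m M N) p
        q₁ = ℕ.≤-trans (ℕ.m≤m⊔n M N) q ; q₂ = ℕ.≤-trans (ℕ.m≤n⊔m M N) q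
        open ℚ.≤-Reasoning in begin-strict
    ℚ.∣ (x m ℚ.+ y m) ℚ.- (x n ℚ.+ y n) ∣
      ≡⟨ cong ℚ.∣_∣ (solve 4 (λ a b c d → (a :+ b) :- (c :+ d) := (a :- c) :+ (b :- d))
                       refl (x m) (y m) (x n) (y n)) ⟩
    ℚ.∣ (x m ℚ.- x n) ℚ.+ (y m ℚ.- y n) ∣
      ≤⟨ ℚ.∣p+q∣≤∣p∣+∣q∣ (x m ℚ.- x n) (y m ℚ.- y n) ⟩
    ℚ.∣ x m ℚ.- x n ∣ ℚ.+ ℚ.∣ y m ℚ.- y n ∣
      <⟨ ℚ.+-mono-< (h m n p₁ q₁) (k m n p₂ q₂) ⟩
    ½ ℚ.* ε ℚ.+ ½ ℚ.* ε
      ≡⟨ half+half ε ⟩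
    ε ∎

  ⊔0-cauchy′ : ∀ x → IsCauchy x → IsCauchy (λ n → x n ℚ.⊔ 0ℚ)
  ⊔0-cauchy′ x cx ε 0<ε with cx ε 0<ε
  ... | N , h = N , λ m n p q →
    ℚ.≤-<-trans (∣⊔0-⊔0∣≤ (x m) (x n)) (h m n p q)

  bounded : ∀ {x} → IsCauchy x →
    ∃₂ λ B N → 0ℚ ℚ.< B × (∀ n → N ℕ.≤ n → ℚ.∣ x n ∣ ℚ.≤ B)
  bounded {x} cx with cx 1ℚ (ℚ.positive⁻¹ 1ℚ)
  ... | N , h = ℚ.∣ x N ∣ ℚ.+ 1ℚ , N
      , ℚ.+-mono-≤-< (ℚ.0≤∣p∣ (x N)) (ℚ.positive⁻¹ 1ℚ)
      , λ n N≤n → let open ℚ.≤-Reasoning in begin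
    ℚ.∣ x n ∣
      ≡⟨ cong ℚ.∣_∣ (solve 2 (λ a b → a := b :+ (a :- b)) refl (x n) (x N)) ⟩
    ℚ.∣ x N ℚ.+ (x n ℚ.- x N) ∣
      ≤⟨ ℚ.∣p+q∣≤∣p∣+∣q∣ (x N) (x n ℚ.- x N) ⟩
    ℚ.∣ x N ∣ ℚ.+ ℚ.∣ x n ℚ.- x N ∣
      ≤⟨ ℚ.+-monoʳ-≤ ℚ.∣ x N ∣ (ℚ.<⇒≤ (h n N N≤n ℕ.≤-refl)) ⟩
    ℚ.∣ x N ∣ ℚ.+ 1ℚ ∎

  *-bound : ∀ {p q B d} → 0ℚ ℚ.< B → ℚ.∣ p ∣ ℚ.≤ B → ℚ.∣ q ∣ ℚ.< d →
            ℚ.∣ p ℚ.* q ∣ ℚ.< B ℚ.* d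
  *-bound {p} {q} {B} {d} 0<B p≤B q<d = let open ℚ.≤-Reasoning in begin-strict
    ℚ.∣ p ℚ.* q ∣
      ≡⟨ ℚ.∣p*q∣≡∣p∣*∣q∣ p q ⟩
    ℚ.∣ p ∣ ℚ.* ℚ.∣ q ∣
      ≤⟨ ℚ.*-monoʳ-≤-nonNeg ℚ.∣ q ∣ {{ℚ.∣-∣-nonNeg q}} p≤B ⟩
    B ℚ.* ℚ.∣ q ∣
      <⟨ ℚ.*-monoʳ-<-pos B {{ℚ.positive 0<B}} q<d ⟩
    B ℚ.* d ∎

  *-diff : ∀ a b c d → a ℚ.* b ℚ.- c ℚ.* d ≡ a ℚ.* (b ℚ.- d) ℚ.+ d ℚ.* (a ℚ.- c)
  *-diff a b c d = solve 4
    (λ a b c d → a :* b :- c :* d := a :* (b :- d) :+ d :* (a :- c)) refl a b c d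

  divide : ∀ {S ε} → 0ℚ ℚ.< S → 0ℚ ℚ.< ε → ∃ λ δ → 0ℚ ℚ.< δ × S ℚ.* δ ≡ ε
  divide {S} {ε} 0<S 0<ε = S⁻¹ ℚ.* ε , 0<δ ,
    trans (sym (ℚ.*-assoc S S⁻¹ ε))
      (trans (cong (ℚ._* ε) (ℚ.*-inverseʳ S {{S≢0}})) (ℚ.*-identityˡ ε))
    where
    S≢0 : ℚ.NonZero S
    S≢0 = ℚ.pos⇒nonZero S {{ℚ.positive 0<S}}
    S⁻¹ : ℚ
    S⁻¹ = (ℚ.1/ S) {{S≢0}}
    0<δ : 0ℚ ℚ.< S⁻¹ ℚ.* ε
    0<δ = subst (ℚ._< S⁻¹ ℚ.* ε) (ℚ.*-zeroʳ S⁻¹)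
      (ℚ.*-monoʳ-<-pos S⁻¹ {{ℚ.1/pos⇒pos S {{ℚ.positive 0<S}}}} 0<ε)

  *-close : ∀ {a b c d A B δ} → 0ℚ ℚ.< A → 0ℚ ℚ.< B →
    ℚ.∣ a ∣ ℚ.≤ A → ℚ.∣ d ∣ ℚ.≤ B → ℚ.∣ a ℚ.- c ∣ ℚ.< δ → ℚ.∣ b ℚ.- d ∣ ℚ.< δ →
    ℚ.∣ a ℚ.* b ℚ.- c ℚ.* d ∣ ℚ.< (A ℚ.+ B) ℚ.* δ
  *-close {a} {b} {c} {d} {A} {B} {δ} 0<A 0<B a≤A d≤B ac bd = begin-strict
    ℚ.∣ a ℚ.* b ℚ.- c ℚ.* d ∣
      ≡⟨ cong ℚ.∣_∣ (*-diff a b c d) ⟩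
    ℚ.∣ a ℚ.* (b ℚ.- d) ℚ.+ d ℚ.* (a ℚ.- c) ∣
      ≤⟨ ℚ.∣p+q∣≤∣p∣+∣q∣ (a ℚ.* (b ℚ.- d)) (d ℚ.* (a ℚ.- c)) ⟩
    ℚ.∣ a ℚ.* (b ℚ.- d) ∣ ℚ.+ ℚ.∣ d ℚ.* (a ℚ.- c) ∣
      <⟨ ℚ.+-mono-< (*-bound {a} {b ℚ.- d} 0<A a≤A bd) (*-bound {d} {a ℚ.- c} 0<B d≤B ac) ⟩
    A ℚ.* δ ℚ.+ B ℚ.* δ
      ≡⟨ ℚ.*-distribʳ-+ δ A B ⟨
    (A ℚ.+ B) ℚ.* δ ∎
    where open ℚ.≤-Reasoning

  *-cauchy′ : ∀ x y → IsCauchy x → IsCauchy y → IsCauchy (λ n → x n ℚ.* y n)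
  *-cauchy′ x y cx cy ε 0<ε = choose (bounded cx) (bounded cy)
    where
    Bounded : (ℕ → ℚ) → Set
    Bounded z = ∃₂ λ B N → 0ℚ ℚ.< B × (∀ n → N ℕ.≤ n → ℚ.∣ z n ∣ ℚ.≤ B)

    choose : Bounded x → Bounded y →
      ∃ λ N → ∀ m n → N ℕ.≤ m → N ℕ.≤ n → ℚ.∣ x m ℚ.* y m ℚ.- x n ℚ.* y n ∣ ℚ.< ε
    choose (A , K , 0<A , ∣x∣≤A) (B , L , 0<B , ∣y∣≤B) = close δ-exists
      where
      δ-exists : ∃ λ δ → 0ℚ ℚ.< δ × (A ℚ.+ B) ℚ.* δ ≡ ε
      δ-exists = divide (ℚ.+-mono-< 0<A 0<B) 0<ε

      close : (∃ λ δ → 0ℚ ℚ.< δ × (A ℚ.+ B) ℚ.* δ ≡ ε) →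
        ∃ λ N → ∀ m n → N ℕ.≤ m → N ℕ.≤ n → ℚ.∣ x m ℚ.* y m ℚ.- x n ℚ.* y n ∣ ℚ.< ε
      close (δ , 0<δ , Sδ≡ε) = (M ℕ.⊔ K) ℕ.⊔ (N ℕ.⊔ L) , λ m n p q →
        let p₁ = ℕ.m⊔n≤o⇒m≤o (M ℕ.⊔ K) (N ℕ.⊔ L) p
            q₁ = ℕ.m⊔n≤o⇒m≤o (M ℕ.⊔ K) (N ℕ.⊔ L) q
            p₂ = ℕ.m⊔n≤o⇒n≤o (M ℕ.⊔ K) (N ℕ.⊔ L) p
            q₂ = ℕ.m⊔n≤o⇒n≤o (M ℕ.⊔ K) (N ℕ.⊔ L) q
        in subst (ℚ.∣ x m ℚ.* y m ℚ.- x n ℚ.* y n ∣ ℚ.<_) Sδ≡ε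
             (*-close {x m} {y m} {x n} {y n} {A} {B} {δ} 0<A 0<B
               (∣x∣≤A m (ℕ.m⊔n≤o⇒n≤o M K p₁))
               (∣y∣≤B n (ℕ.m⊔n≤o⇒n≤o N L q₂))
               (proj₂ (cx δ 0<δ) m n (ℕ.m⊔n≤o⇒m≤o M K p₁) (ℕ.m⊔n≤o⇒m≤o M K q₁))
               (proj₂ (cy δ 0<δ) m n (ℕ.m⊔n≤o⇒m≤o N L p₂) (ℕ.m⊔n≤o⇒m≤o N L q₂)))
        where
        M = proj₁ (cx δ 0<δ)
        N = proj₁ (cy δ 0<δ)

private abstract
  -- Sealed, so that normalising a real never unfolds these proofs.
  const-cauchy : ∀ q → IsCauchy (λ _ → q)
  const-cauchy = const-cauchy′

  neg-cauchy : ∀ x → IsCauchy x → IsCauchy (λ n → ℚ.- x n)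
  neg-cauchy = neg-cauchy′

  +-cauchy : ∀ x y → IsCauchy x → IsCauchy y → IsCauchy (λ n → x n ℚ.+ y n)
  +-cauchy = +-cauchy′

  ⊔0-cauchy : ∀ x → IsCauchy x → IsCauchy (λ n → x n ℚ.⊔ 0ℚ)
  ⊔0-cauchy = ⊔0-cauchy′

  *-cauchy : ∀ x y → IsCauchy x → IsCauchy y → IsCauchy (λ n → x n ℚ.* y n)
  *-cauchy = *-cauchy′

infixl 6 _+ℝ_ _-ℝ_
infixl 7 _*ℝ_

fromℚ : ℚ → ℝ
fromℚ q = mkℝ (λ _ → q) (const-cauchy q)

0ℝ : ℝ
0ℝ = fromℚ 0ℚ

_+ℝ_ : ℝ → ℝ → ℝ
x +ℝ y = mkℝ (λ n → seq x n ℚ.+ seq y n) (+-cauchy (seq x) (seq y) (cauchy x) (cauchy y))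

-ℝ_ : ℝ → ℝ
-ℝ x = mkℝ (λ n → ℚ.- seq x n) (neg-cauchy (seq x) (cauchy x))

_-ℝ_ : ℝ → ℝ → ℝ
x -ℝ y = x +ℝ (-ℝ y)

_*ℝ_ : ℝ → ℝ → ℝ
x *ℝ y = mkℝ (λ n → seq x n ℚ.* seq y n) (*-cauchy (seq x) (seq y) (cauchy x) (cauchy y))

[_]₊ : ℝ → ℝ
[ x ]₊ = mkℝ (λ n → seq x n ℚ.⊔ 0ℚ) (⊔0-cauchy (seq x) (cauchy x))

-- A minimum is attained.
IsMin : {A : Set} → (A → ℝ) → ℝ → Set
IsMin f v = (∃ λ a → f a ≃ v) × (∀ a → v ≤ℝ f a)

------------------------------------------------------------------------
-- Training error of a single ReLU

⟨_,_⟩ : ∀ {d} → Vec ℝ d → Vec ℝ d → ℝ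
⟨ w , x ⟩ = Vec.foldr′ _+ℝ_ 0ℝ (Vec.zipWith _*ℝ_ w x)

squaredLoss : ∀ {d} → Vec ℝ d → Vec ℝ d × ℝ → ℝ
squaredLoss w (x , y) = r *ℝ r
  where r = [ ⟨ w , x ⟩ ]₊ -ℝ y

trainingError : ∀ {d} → List (Vec ℝ d × ℝ) → Vec ℝ d → ℝ
trainingError samples w = List.foldr _+ℝ_ 0ℝ (List.map (squaredLoss w) samples)

-- The output of an algorithm is a finite string, so the numbers it writes
-- down are rational; they are read as real numbers.
record Samples : Set where
  field
    dim    : ℕ
    points : List (Vec ℚ dim × ℚ)

  realSamples : List (Vec ℝ dim × ℝ)
  realSamples = List.map (Product.map (Vec.map fromℚ) fromℚ) points

  error : Vec ℝ dim → ℝ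
  error = trainingError realSamples

open Samples public

------------------------------------------------------------------------
-- Monotone circuits

data GateType : Set where
  AND OR : GateType

-- A gate reading a nonempty set of the k wires built before it.
record Gate (k : ℕ) : Set where
  constructor gate
  field
    type     : GateType
    fanIn    : Subset k
    nonempty : Nonempty fanIn

open Gate public

-- Gates n k : gates in topological order over n input wires, with k wires
-- in total: the n input wires and one output wire for each gate.  Index 0 is
-- the output wire of the gate added last.
infixl 5 _▹_

data Gates (n : ℕ) : ℕ → Set where
  inputs : Gates n n
  _▹_    : ∀ {k} → Gates n k → Gate k → Gates n (suc k)

gateValue : ∀ {k} → Gate k → Subset k → Bool
gateValue (gate AND s _) v = does (s ⊆? v)
gateValue (gate OR  s _) v = does (nonempty? (s ∩ v))

-- The set of wires carrying True when the set of True inputs is x.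
values : ∀ {n k} → Gates n k → Subset n → Subset k
values inputs   x = x
values (G ▹ g) x = gateValue g (values G x) ∷ values G x

gateDepth : ∀ {k} → Gate k → Vec ℕ k → ℕ
gateDepth g ds = suc (Vec.foldr′ ℕ._⊔_ 0
  (Vec.zipWith (λ reads d → if reads then d else 0) (fanIn g) ds))

-- The maximal number of gates on a path from an input wire to each wire.
depths : ∀ {n k} → Gates n k → Vec ℕ k
depths {n} inputs = Vec.replicate n 0
depths (G ▹ g) = gateDepth g (depths G) ∷ depths G

record Circuit : Set where
  field
    #inputs : ℕ
    #wires  : ℕ
    gates   : Gates #inputs #wires
    output  : Fin #wires

open Circuit public

size : Circuit → ℕ
size = #wires

depth : Circuit → ℕ
depth C = lookup (depths (gates C)) (output C)

eval : (C : Circuit) → Subset (#inputs C) → Bool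
eval C x = lookup (values (gates C) x) (output C)

IsOpt : Circuit → ℕ → Set
IsOpt C k = (∃ λ x → eval C x ≡ true × ∣ x ∣ ≡ k)
          × (∀ x → eval C x ≡ true → k ℕ.≤ ∣ x ∣)

private
  ⊤-gateValue : ∀ {k} (g : Gate k) → gateValue g ⊤ ≡ true
  ⊤-gateValue (gate AND s _)         = dec-true (s ⊆? ⊤) ⊆⊤
  ⊤-gateValue (gate OR  s (i , i∈s)) =
    dec-true (nonempty? (s ∩ ⊤)) (i , x∈p∩q⁺ (i∈s , ∈⊤))

  ⊤-values : ∀ {n k} (G : Gates n k) → values G ⊤ ≡ ⊤
  ⊤-values inputs = refl
  ⊤-values (G ▹ g) = cong₂ _∷_
    (trans (cong (gateValue g) (⊤-values G)) (⊤-gateValue g)) (⊤-values G)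

  lookup-⊤ : ∀ {k} (i : Fin k) → lookup ⊤ i ≡ true
  lookup-⊤ zero    = refl
  lookup-⊤ (suc i) = lookup-⊤ i

  least : {P : ℕ → Set} → Decidable P → ∀ n → P n →
          ∃ λ k → P k × (∀ j → P j → k ℕ.≤ j)
  least P? n p with P? 0
  least P? n       p | yes p₀ = 0 , p₀ , λ _ _ → ℕ.z≤n
  least P? zero    p | no ¬p₀ = case ¬p₀ p of λ ()
  least P? (suc n) p | no ¬p₀ with least (P? ∘ suc) n p
  ... | k , pk , min = suc k , pk , λ where
    zero    p₀ → case ¬p₀ p₀ of λ ()
    (suc j) pj → ℕ.s≤s (min j pj)

-- Setting every input wire to True satisfies the circuit, so opt is defined.
opt-exists : ∀ C → ∃ (IsOpt C)
opt-exists C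
  with k , sat , min ← least
         (λ k → anySubset? λ x → (eval C x Bool.≟ true) ×-dec (∣ x ∣ ℕ.≟ k))
         ∣ ⊤ {#inputs C} ∣
         (⊤ , trans (cong (λ v → lookup v (output C)) (⊤-values (gates C)))
                    (lookup-⊤ (output C)) , refl)
  = k , sat , λ x e → min ∣ x ∣ (x , e , refl)

opt : Circuit → ℕ
opt C = proj₁ (opt-exists C)

scale≢0 : ∀ C ℓ → ℕ.NonZero ((10 ℕ.* size C) ℕ.^ (2 ℕ.* ℓ ℕ.+ 2))
scale≢0 C ℓ =
  ℕ.m^n≢0 (10 ℕ.* size C) (2 ℕ.* ℓ ℕ.+ 2)
    {{ℕ.m*n≢0 10 (size C) {{_}} {{nonZeroIndex (output C)}}}}

------------------------------------------------------------------------
-- Multi-stack machines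
--
-- Finitely many stacks over a fixed alphabet with structured finite control.
-- Every step touches one symbol; two stacks are the two halves of a Turing
-- tape, so running times agree with multitape Turing machines up to a
-- constant factor.

data Symbol : Set where
  𝟎 𝟏 ♯ : Symbol

State : ℕ → Set
State k = Vec (List Symbol) k

data Program (k : ℕ) : Set where
  skip         : Program k
  push         : Fin k → Symbol → Program k
  pop          : Fin k → Program k
  _⨾_          : Program k → Program k → Program k
  if_on_then_else_ : (Maybe Symbol → Bool) → Fin k → Program k → Program k → Program k
  while_on_loop_   : (Maybe Symbol → Bool) → Fin k → Program k → Program k

infixr 4 _⨾_

top : ∀ {k} → State k → Fin k → Maybe Symbol
top s i = List.head (lookup s i)

-- Runs P s t s′ : started in s, P halts in s′ after t steps.
data Runs {k : ℕ} : Program k → State k → ℕ → State k → Set where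
  skip : ∀ {s} → Runs skip s 1 s
  push : ∀ {s i a} → Runs (push i a) s 1 (s [ i ]%= (a ∷_))
  pop  : ∀ {s i} → Runs (pop i) s 1 (s [ i ]%= List.drop 1)
  comp : ∀ {P Q s s′ s″ t u} →
         Runs P s t s′ → Runs Q s′ u s″ → Runs (P ⨾ Q) s (t ℕ.+ u) s″
  if-true  : ∀ {b i P Q s s′ t} → b (top s i) ≡ true →
             Runs P s t s′ → Runs (if b on i then P else Q) s (suc t) s′
  if-false : ∀ {b i P Q s s′ t} → b (top s i) ≡ false →
             Runs Q s t s′ → Runs (if b on i then P else Q) s (suc t) s′
  while-false : ∀ {b i P s} → b (top s i) ≡ false →
                Runs (while b on i loop P) s 1 s
  while-true  : ∀ {b i P s s′ s″ t u} → b (top s i) ≡ true →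
                Runs P s t s′ → Runs (while b on i loop P) s′ u s″ →
                Runs (while b on i loop P) s (suc (t ℕ.+ u)) s″

-- f is computable in polynomial time on the inputs satisfying Valid.  The
-- input is given, and the output is left, on stack 0, first symbol on top.
PolyTimeOn : {A B : Set} → (A → List Symbol) → (B → List Symbol) →
             (A → Set) → (A → B) → Set
PolyTimeOn {A} encA encB Valid f =
  ∃ λ k → ∃ λ (P : Program (suc k)) → ∃₂ λ c e → ∀ (a : A) → Valid a →
  ∃₂ λ t s → Runs P (encA a ∷ Vec.replicate k []) t s
           × lookup s zero ≡ encB (f a)
           × t ℕ.≤ c ℕ.* List.length (encA a) ℕ.^ e ℕ.+ c

------------------------------------------------------------------------
-- Encodings as strings

encodeUnary : ℕ → List Symbol
encodeUnary n = List.replicate n 𝟏 ++ ♯ ∷ []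

encodeSubset : ∀ {k} → Subset k → List Symbol
encodeSubset s = List.map (λ b → if b then 𝟏 else 𝟎) (Vec.toList s) ++ ♯ ∷ []

encodeType : GateType → Symbol
encodeType AND = 𝟏
encodeType OR  = 𝟎

encodeGates : ∀ {n k} → Gates n k → List Symbol
encodeGates {n} inputs = 𝟎 ∷ encodeUnary n
encodeGates (G ▹ g) = 𝟏 ∷ encodeType (type g) ∷ encodeSubset (fanIn g) ++ encodeGates G

encodeCircuit : Circuit → List Symbol
encodeCircuit C = encodeSubset ⁅ output C ⁆ ++ encodeGates (gates C)

-- Binary digits, least significant first, with digit values 1 (𝟏) and 2 (𝟎).
encodeℕᵇ : ℕᵇ → List Symbol
encodeℕᵇ ℕᵇ.zero  = ♯ ∷ []
encodeℕᵇ 2[1+ n ] = 𝟎 ∷ encodeℕᵇ n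
encodeℕᵇ 1+[2 n ] = 𝟏 ∷ encodeℕᵇ n

encodeℕ : ℕ → List Symbol
encodeℕ n = encodeℕᵇ (ℕᵇ.fromℕ n)

encodeSign : Sign → Symbol
encodeSign Sign.+ = 𝟏
encodeSign Sign.- = 𝟎

encodeℤ : ℤ → List Symbol
encodeℤ i = encodeSign (ℤ.sign i) ∷ encodeℕ ℤ.∣ i ∣

encodeℚ : ℚ → List Symbol
encodeℚ q = encodeℤ (ℚ.↥ q) ++ encodeℕ (ℚ.↧ₙ q)

encodePoints : ∀ {d} → List (Vec ℚ d × ℚ) → List Symbol
encodePoints [] = ♯ ∷ []
encodePoints ((x , y) ∷ xys) =
  𝟏 ∷ List.concatMap encodeℚ (Vec.toList x) ++ encodeℚ y ++ encodePoints xys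

encodeSamples : Samples → List Symbol
encodeSamples S = encodeUnary (dim S) ++ encodePoints (points S)

{-# OPTIONS --safe #-}
-- The weights are one real per wire and an extra one, u, which a sample with
-- target 2 holds above 1 as long as the error is below 1.  Every clause S of a
-- gate g (one clause for OR, a singleton per input for AND) becomes a sample
-- with target 0 penalising u + w_g - sum_S w.  When the error is below 1 these
-- samples make the weight of g negative if g is False on the inputs that are
-- True exactly where w_i >= 0, and the sample penalising u - w_out makes the
-- weight of the output positive, so these inputs satisfy the circuit.  An input
-- costs ([-w_i]_+ - q)^2, which is exactly q^2 whenever w_i >= 0 and vanishes
-- at w_i = -q; with q = (10 |C|)^-(l+1) the error is at least opt C * q^2.
-- Equality holds when the weights of True wires are large compared to those of
-- False wires.  As u makes the inequality at each gate strict, no slack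
-- accumulates along paths and the depth only enters through q.
--
-- All coefficients are 0, 1 or -1, and 1/q is polynomial in |C| for fixed l, so
-- a machine can compute it in unary and then count it in binary.
module Submission where

open import Defs
open import Data.Bool.Base using (Bool; true; false; if_then_else_)
open import Data.Fin.Base using (Fin; zero; suc)
open import Data.Fin.Properties as Fin using (any?; nonZeroIndex)
open import Data.Fin.Subset using (Subset; _∩_; _∈_; _∉_; ∣_∣; ⁅_⁆; ⊤; ⊥)
open import Data.Fin.Subset.Properties
  using (_⊆?_; _∈?_; ∣p∣≤n; nonempty?; x∈p∩q⁺; x∈p∩q⁻; x∈⁅x⁆; x∈⁅y⁆⇒x≡y; drop-there)
import Data.Integer.Base as ℤ
import Data.Integer.Properties as ℤ
import Data.Integer.Solver as ℤ
open import Data.List.Base as List using (List; []; _∷_; _++_)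
import Data.List.Properties as List
open import Data.List.Relation.Unary.All as All using (All; []; _∷_)
import Data.List.Relation.Unary.All.Properties as All
open import Data.List.Relation.Unary.Any as Any using (Any)
import Data.List.Relation.Unary.Any.Properties as Any
open import Data.Maybe.Base using (Maybe; just; is-just)
open import Data.Nat.Base as ℕ using (ℕ; zero; suc)
open import Data.Nat.Binary.Base as ℕᵇ using (ℕᵇ; 2[1+_]; 1+[2_])
import Data.Nat.Binary.Properties as ℕᵇ
open import Data.Nat.Coprimality using (1-coprimeTo)
import Data.Nat.Properties as ℕ
import Data.Nat.Solver as ℕ
open import Data.Product.Base as Product using (∃; ∃₂; _×_; _,_; proj₁; proj₂)
open import Data.Rational.Base as ℚ using (ℚ; mkℚ; 0ℚ; 1ℚ)
import Data.Rational.Properties as ℚ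
import Data.Rational.Solver as ℚ
import Data.Rational.Unnormalised.Base as ℚᵘ
import Data.Rational.Unnormalised.Properties as ℚᵘ
open import Data.Sum.Base using (inj₁; inj₂)
open import Data.Vec.Base as Vec
  using (Vec; []; _∷_; here; there; lookup; toList; _[_]%=_; _[_]≔_)
import Data.Vec.Properties as Vec
open import Function.Base using (_∘_; case_of_)
open import Relation.Binary.PropositionalEquality hiding ([_])
open import Relation.Nullary using (¬_; Dec; yes; no; does; contradiction)
open import Relation.Nullary.Decidable using (True; toWitness; ¬?; _×-dec_; decidable-stable)

-- Everything reduces to rational inequalities: the error is computed termwise on Cauchy sequences,
-- so a lower bound valid for all rational weights holds at every index, and the minimum is attained
-- at a rational point. Both gate types are read as conjunctions of clauses: a gate is True exactly
-- when each of its clauses contains a True wire. The one-sidedness of the ReLU matches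
-- monotonicity, since a sample with target 0 penalises only positive values of its linear form;
-- this forces False through the gates and nothing on True wires. The number 1 splits the lower
-- bound. Weights of error at least 1 are harmless, because opt is at most the number of inputs and
-- hence at most 1/q^2, so the claimed minimum is at most 1. Below 1, the targets 2 and 0 give
-- `1 < u` and `u + z < 1` for each row `z`, hence `z < 0`. The weights exhibited for the upper
-- bound can be exponential in the number of wires, which costs nothing as the machine never writes
-- them. Wire 0 is the latest gate, and the input string also lists gates latest first, so one pass
-- over it suffices, with a growing prefix of zeros shared by all later rows.

module Optimum where

  open import Data.Rational.Base using (_/_; _≤_; _<_; _+_; _*_; -_; _-_; _⊔_; _⊓_)
  open ℚ.+-*-Solver using (solve; _:=_; _:+_; _:*_; _:-_; :-_)

  -- Samples attached to a circuit

  2ℚ : ℚ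
  2ℚ = 1ℚ + 1ℚ

  -- Symbols double as the coefficients 0, 1 and -1 of a sample.
  coefficient : Symbol → ℚ
  coefficient 𝟎 = 0ℚ
  coefficient 𝟏 = 1ℚ
  coefficient ♯ = - 1ℚ

  literal : Bool → Symbol
  literal b = if b then ♯ else 𝟎

  literals : ∀ {k} → Subset k → Vec Symbol k
  literals = Vec.map literal

  singletons : ∀ {k} → Subset k → List (Subset k)
  singletons []          = []
  singletons (true  ∷ s) = (true ∷ ⊥) ∷ List.map (false ∷_) (singletons s)
  singletons (false ∷ s) = List.map (false ∷_) (singletons s)

  clauses : ∀ {k} → Gate k → List (Subset k)
  clauses (gate AND s _) = singletons s
  clauses (gate OR  s _) = s ∷ []

  gateRows : ∀ {n k} → Gates n k → List (Vec Symbol k)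
  gateRows inputs  = []
  gateRows (G ▹ g) =
    List.map (λ c → 𝟏 ∷ literals c) (clauses g) ++ List.map (𝟎 ∷_) (gateRows G)

  inputRows : ∀ {n k} → Gates n k → List (Vec Symbol k)
  inputRows inputs  = List.map literals (singletons ⊤)
  inputRows (G ▹ _) = List.map (𝟎 ∷_) (inputRows G)

  -- Equal to 1 for m = 0.
  reciprocal : ℕ → ℚ
  reciprocal m = mkℚ (ℤ.+ 1) (ℕ.pred m) (1-coprimeTo _)

  -- The variables are one weight per wire, preceded by an extra weight u which
  -- the last sample holds near 2.
  sample : ∀ {k} → Symbol → ℚ → Vec Symbol k → Vec ℚ (suc k) × ℚ
  sample s q r = Vec.map coefficient (s ∷ r) , q

  module _ {n k : ℕ} (G : Gates n k) (o : Fin k) (q : ℚ) where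

    outputSample : Vec ℚ (suc k) × ℚ
    outputSample = sample 𝟏 0ℚ (literals ⁅ o ⁆)

    unitSample : Vec ℚ (suc k) × ℚ
    unitSample = sample 𝟏 2ℚ (Vec.replicate k 𝟎)

    circuitSamples : List (Vec ℚ (suc k) × ℚ)
    circuitSamples = outputSample
      ∷ List.map (sample 𝟏 0ℚ) (gateRows G)
      ++ List.map (sample 𝟎 q) (inputRows G)
      ++ unitSample ∷ []

  -- Its reciprocal is the target of the input samples. The exponent is half of `2 ℓ + 2`, since
  -- each True input costs the square of that target.
  targetScale : ℕ → Circuit → ℕ
  targetScale ℓ C = (10 ℕ.* size C) ℕ.^ suc ℓ

  reduction : ℕ → Circuit → Samples
  reduction ℓ C = record
    { dim    = suc (size C)
    ; points = circuitSamples (gates C) (output C) (reciprocal (targetScale ℓ C))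
    }

  -- Training error over the rationals

  dot : ∀ {d} → Vec ℚ d → Vec ℚ d → ℚ
  dot w x = Vec.foldr′ _+_ 0ℚ (Vec.zipWith _*_ w x)

  reluLoss : ℚ → ℚ → ℚ
  reluLoss z q = ((z ⊔ 0ℚ) - q) * ((z ⊔ 0ℚ) - q)

  loss : ∀ {d} → Vec ℚ d → Vec ℚ d × ℚ → ℚ
  loss w (x , q) = reluLoss (dot w x) q

  total : {A : Set} → (A → ℚ) → List A → ℚ
  total f xs = List.foldr _+_ 0ℚ (List.map f xs)

  seq-⟨⟩ : ∀ {d} n (w : Vec ℝ d) (x : Vec ℚ d) →
    seq ⟨ w , Vec.map fromℚ x ⟩ n ≡ dot (Vec.map (λ a → seq a n) w) x
  seq-⟨⟩ n []      []      = refl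
  seq-⟨⟩ n (a ∷ w) (b ∷ x) = cong (λ z → seq a n * b + z) (seq-⟨⟩ n w x)

  seq-error : ∀ {d} n (w : Vec ℝ d) (ps : List (Vec ℚ d × ℚ)) →
    seq (trainingError (List.map (Product.map (Vec.map fromℚ) fromℚ) ps) w) n
      ≡ total (loss (Vec.map (λ a → seq a n) w)) ps
  seq-error n w []             = refl
  seq-error n w ((x , q) ∷ ps) =
    cong₂ _+_ (cong (λ z → reluLoss z q) (seq-⟨⟩ n w x)) (seq-error n w ps)

  constants : ∀ {d} n (w : Vec ℚ d) → Vec.map (λ a → seq a n) (Vec.map fromℚ w) ≡ w
  constants n []      = refl
  constants n (a ∷ w) = cong (a ∷_) (constants n w)

  p≤q+p : ∀ {p q} → 0ℚ ≤ q → p ≤ q + p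
  p≤q+p {p} {q} 0≤q = subst (_≤ q + p) (ℚ.+-identityˡ p) (ℚ.+-monoˡ-≤ p 0≤q)

  p≤p+q : ∀ {p q} → 0ℚ ≤ q → p ≤ p + q
  p≤p+q {p} {q} 0≤q = subst (_≤ p + q) (ℚ.+-identityʳ p) (ℚ.+-monoʳ-≤ p 0≤q)

  -- At index `n` the error of a real weight vector is the rational error of its `n`-th
  -- approximation, so both parts of `IsMin` hold from index 0 on.
  isMin : ∀ S v →
    (∃ λ w → total (loss w) (points S) ≡ v) → (∀ w → v ≤ total (loss w) (points S)) →
    IsMin (error S) (fromℚ v)
  isMin S v (w , attained) lower = (Vec.map fromℚ w , close) , below
    where
    close : error S (Vec.map fromℚ w) ≃ fromℚ v
    close ε 0<ε = 0 , λ n _ → subst (λ z → ℚ.∣ z - v ∣ < ε)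
      (sym (trans (seq-error n (Vec.map fromℚ w) (points S))
             (trans (cong (λ w → total (loss w) (points S)) (constants n w)) attained)))
      (subst (_< ε) (cong ℚ.∣_∣ (sym (ℚ.+-inverseʳ v))) 0<ε)

    below : ∀ w → fromℚ v ≤ℝ error S w
    below w ε 0<ε = 0 , λ n _ → subst (λ z → v ≤ z + ε)
      (sym (seq-error n w (points S)))
      (ℚ.≤-trans (lower (Vec.map (λ a → seq a n) w)) (p≤p+q (ℚ.<⇒≤ 0<ε)))

  -- Sums of losses

  square-nonNeg : ∀ r → 0ℚ ≤ r * r
  square-nonNeg r with ℚ.≤-total 0ℚ r
  ... | inj₁ 0≤r = subst (_≤ r * r) (ℚ.*-zeroˡ r)
        (ℚ.*-monoʳ-≤-nonNeg r {{ℚ.nonNegative 0≤r}} 0≤r)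
  ... | inj₂ r≤0 = subst (_≤ r * r) (ℚ.*-zeroˡ r)
        (ℚ.*-monoʳ-≤-nonPos r {{ℚ.nonPositive r≤0}} r≤0)

  1≤square : ∀ {r} → 1ℚ ≤ r → 1ℚ ≤ r * r
  1≤square {r} 1≤r = ℚ.≤-trans 1≤r (subst (_≤ r * r) (ℚ.*-identityˡ r)
    (ℚ.*-monoʳ-≤-nonNeg r {{ℚ.nonNegative (ℚ.≤-trans (ℚ.nonNegative⁻¹ 1ℚ) 1≤r)}} 1≤r))

  p-0≡p : ∀ p → p - 0ℚ ≡ p
  p-0≡p = ℚ.+-identityʳ

  <⇒≱ : ∀ {p q} → p < q → ¬ q ≤ p
  <⇒≱ p<q q≤p = ℚ.<-irrefl refl (ℚ.<-≤-trans p<q q≤p)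

  reluLoss-nonNeg : ∀ z q → 0ℚ ≤ reluLoss z q
  reluLoss-nonNeg z q = square-nonNeg ((z ⊔ 0ℚ) - q)

  reluLoss₀-<1 : ∀ {z} → reluLoss z 0ℚ < 1ℚ → z < 1ℚ
  reluLoss₀-<1 {z} l = ℚ.≰⇒> λ 1≤z → <⇒≱ l
    (1≤square (subst (1ℚ ≤_) (sym (p-0≡p (z ⊔ 0ℚ))) (ℚ.≤-trans 1≤z (ℚ.p≤p⊔q z 0ℚ))))

  reluLoss₀-≡0 : ∀ {z} → z ≤ 0ℚ → reluLoss z 0ℚ ≡ 0ℚ
  reluLoss₀-≡0 {z} z≤0 = cong (λ p → (p - 0ℚ) * (p - 0ℚ)) (ℚ.p≤q⇒p⊔q≡q z≤0)

  -- For `z ≤ 1` the clipped value stays at distance at least 1 from the target. Target 2 is what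
  -- places this gap above the bound 1 that the samples with target 0 enforce.
  reluLoss₂-<1 : ∀ {z} → reluLoss z 2ℚ < 1ℚ → 1ℚ < z
  reluLoss₂-<1 {z} l = ℚ.≰⇒> λ z≤1 → <⇒≱ l
    (subst (1ℚ ≤_)
      (solve 2 (λ a b → (b :- a) :* (b :- a) := (a :- b) :* (a :- b)) refl (z ⊔ 0ℚ) 2ℚ)
      (1≤square (ℚ.+-monoʳ-≤ 2ℚ (ℚ.neg-antimono-≤ (ℚ.⊔-lub z≤1 (ℚ.nonNegative⁻¹ 1ℚ))))))

  reluLoss-self : ∀ {z q} → 0ℚ ≤ q → z ≡ q → reluLoss z q ≡ 0ℚ
  reluLoss-self {q = q} 0≤q refl =
    trans (cong (λ p → (p - q) * (p - q)) (ℚ.p≥q⇒p⊔q≡p 0≤q))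
      (cong (λ p → p * p) (ℚ.+-inverseʳ q))

  reluLoss-nonPos : ∀ {z} q → z ≤ 0ℚ → reluLoss z q ≡ q * q
  reluLoss-nonPos q z≤0 =
    trans (cong (λ p → (p - q) * (p - q)) (ℚ.p≤q⇒p⊔q≡q z≤0))
      (trans (cong (λ p → p * p) (ℚ.+-identityˡ (- q)))
        (solve 1 (λ q → (:- q) :* (:- q) := q :* q) refl q))

  total-nonNeg : ∀ {A : Set} {f : A → ℚ} → (∀ x → 0ℚ ≤ f x) → ∀ xs → 0ℚ ≤ total f xs
  total-nonNeg 0≤f []       = ℚ.≤-refl
  total-nonNeg 0≤f (x ∷ xs) = ℚ.+-mono-≤ (0≤f x) (total-nonNeg 0≤f xs)

  total-++ : ∀ {A : Set} (f : A → ℚ) xs ys → total f (xs ++ ys) ≡ total f xs + total f ys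
  total-++ f []       ys = sym (ℚ.+-identityˡ _)
  total-++ f (x ∷ xs) ys =
    trans (cong (f x +_) (total-++ f xs ys)) (sym (ℚ.+-assoc (f x) (total f xs) (total f ys)))

  total-cong : ∀ {A : Set} {f g : A → ℚ} → f ≗ g → total f ≗ total g
  total-cong f≗g []       = refl
  total-cong f≗g (x ∷ xs) = cong₂ _+_ (f≗g x) (total-cong f≗g xs)

  total-map : ∀ {A B : Set} (f : B → ℚ) (g : A → B) xs → total f (List.map g xs) ≡ total (f ∘ g) xs
  total-map f g []       = refl
  total-map f g (x ∷ xs) = cong (f (g x) +_) (total-map f g xs)

  total-zero : ∀ {A : Set} {f : A → ℚ} {xs} → All (λ x → f x ≡ 0ℚ) xs → total f xs ≡ 0ℚ
  total-zero []       = refl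
  total-zero (e ∷ es) = cong₂ _+_ e (total-zero es)

  all≤total : ∀ {A : Set} {f : A → ℚ} → (∀ x → 0ℚ ≤ f x) → ∀ xs → All (λ x → f x ≤ total f xs) xs
  all≤total 0≤f []       = []
  all≤total 0≤f (x ∷ xs) = p≤p+q (total-nonNeg 0≤f xs)
    ∷ All.map (λ l → ℚ.≤-trans l (p≤q+p (0≤f x))) (all≤total 0≤f xs)

  loss-nonNeg : ∀ {d} (w : Vec ℚ d) p → 0ℚ ≤ loss w p
  loss-nonNeg w (x , q) = reluLoss-nonNeg (dot w x) q

  -- Rows as linear forms

  value : ∀ {k} → Vec Symbol k → Vec ℚ k → ℚ
  value r w = dot w (Vec.map coefficient r)

  clauseSum : ∀ {k} → Subset k → Vec ℚ k → ℚ
  clauseSum []          []      = 0ℚ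
  clauseSum (true  ∷ c) (a ∷ w) = a + clauseSum c w
  clauseSum (false ∷ c) (a ∷ w) = clauseSum c w

  value-𝟎∷ : ∀ {k} a (r : Vec Symbol k) w → value (𝟎 ∷ r) (a ∷ w) ≡ value r w
  value-𝟎∷ a r w = trans (cong (_+ value r w) (ℚ.*-zeroʳ a)) (ℚ.+-identityˡ (value r w))

  value-𝟏∷ : ∀ {k} a (r : Vec Symbol k) w → value (𝟏 ∷ r) (a ∷ w) ≡ a + value r w
  value-𝟏∷ a r w = cong (_+ value r w) (ℚ.*-identityʳ a)

  value-literals : ∀ {k} (c : Subset k) w → value (literals c) w ≡ - clauseSum c w
  value-literals []          []      = refl
  value-literals (true  ∷ c) (a ∷ w) = trans
    (cong₂ _+_ (sym (trans (cong -_ (sym (ℚ.*-identityʳ a))) (ℚ.neg-distribʳ-* a 1ℚ))) (value-literals c w))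
    (sym (ℚ.neg-distrib-+ a (clauseSum c w)))
  value-literals (false ∷ c) (a ∷ w) = trans (value-𝟎∷ a (literals c) w) (value-literals c w)

  rowLoss : ∀ {k} → ℚ → Vec ℚ k → Vec Symbol k → ℚ
  rowLoss q w r = reluLoss (value r w) q

  total-𝟎∷ : ∀ {k} q a (w : Vec ℚ k) rs →
    total (rowLoss q (a ∷ w)) (List.map (𝟎 ∷_) rs) ≡ total (rowLoss q w) rs
  total-𝟎∷ q a w rs = trans (total-map (rowLoss q (a ∷ w)) (𝟎 ∷_) rs)
    (total-cong (λ r → cong (λ z → reluLoss z q) (value-𝟎∷ a r w)) rs)

  total-false∷ : ∀ {k} q a (w : Vec ℚ k) cs →
    total (rowLoss q (a ∷ w)) (List.map literals (List.map (false ∷_) cs))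
      ≡ total (rowLoss q w) (List.map literals cs)
  total-false∷ q a w cs = trans
    (cong (total (rowLoss q (a ∷ w))) (trans (sym (List.map-∘ cs)) (List.map-∘ cs)))
    (total-𝟎∷ q a w (List.map literals cs))

  value-zeros : ∀ {k} (w : Vec ℚ k) → value (Vec.replicate k 𝟎) w ≡ 0ℚ
  value-zeros []      = refl
  value-zeros (a ∷ w) = trans (value-𝟎∷ a _ w) (value-zeros w)

  clauseSum-⊥ : ∀ {k} (w : Vec ℚ k) → clauseSum ⊥ w ≡ 0ℚ
  clauseSum-⊥ []      = refl
  clauseSum-⊥ (a ∷ w) = clauseSum-⊥ w

  clauseSum-⁅⁆ : ∀ {k} i (w : Vec ℚ k) → clauseSum ⁅ i ⁆ w ≡ lookup w i
  clauseSum-⁅⁆ zero    (a ∷ w) = trans (cong (a +_) (clauseSum-⊥ w)) (ℚ.+-identityʳ a)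
  clauseSum-⁅⁆ (suc i) (a ∷ w) = clauseSum-⁅⁆ i w

  clauseSum-nonPos : ∀ {k} (c : Subset k) w → (∀ i → i ∈ c → lookup w i ≤ 0ℚ) → clauseSum c w ≤ 0ℚ
  clauseSum-nonPos []          []      h = ℚ.≤-refl
  clauseSum-nonPos (true  ∷ c) (a ∷ w) h =
    ℚ.+-mono-≤ (h zero here) (clauseSum-nonPos c w λ i m → h (suc i) (there m))
  clauseSum-nonPos (false ∷ c) (a ∷ w) h = clauseSum-nonPos c w λ i m → h (suc i) (there m)

  -- A lower bound for the sums over all clauses at once.
  negSum : ∀ {k} → Vec ℚ k → ℚ
  negSum []      = 0ℚ
  negSum (a ∷ w) = (a ⊓ 0ℚ) + negSum w

  negSum≤clauseSum : ∀ {k} (c : Subset k) w → negSum w ≤ clauseSum c w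
  negSum≤clauseSum []          []      = ℚ.≤-refl
  negSum≤clauseSum (true  ∷ c) (a ∷ w) = ℚ.+-mono-≤ (ℚ.p⊓q≤p a 0ℚ) (negSum≤clauseSum c w)
  negSum≤clauseSum (false ∷ c) (a ∷ w) = subst (_ ≤_) (ℚ.+-identityˡ _)
    (ℚ.+-mono-≤ (ℚ.p⊓q≤q a 0ℚ) (negSum≤clauseSum c w))

  -- Used with a True wire `i`, which then has to outweigh all negative weights. A negative weight
  -- at `i` is counted twice on the left, which only weakens the bound.
  lookup+negSum≤clauseSum : ∀ {k} (c : Subset k) w i → i ∈ c → lookup w i + negSum w ≤ clauseSum c w
  lookup+negSum≤clauseSum (true ∷ c) (a ∷ w) zero _ = ℚ.+-monoʳ-≤ a
    (subst (_ ≤_) (ℚ.+-identityˡ _) (ℚ.+-mono-≤ (ℚ.p⊓q≤q a 0ℚ) (negSum≤clauseSum c w)))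
  lookup+negSum≤clauseSum (b ∷ c) (a ∷ w) (suc i) m = ℚ.≤-trans
    (ℚ.≤-reflexive (solve 3 (λ x y z → x :+ (y :+ z) := y :+ (x :+ z)) refl (lookup w i) (a ⊓ 0ℚ) (negSum w)))
    (step b (ℚ.+-monoʳ-≤ (a ⊓ 0ℚ) (lookup+negSum≤clauseSum c w i (drop-there m))))
    where
    step : ∀ b {p} → p ≤ (a ⊓ 0ℚ) + clauseSum c w → p ≤ clauseSum (b ∷ c) (a ∷ w)
    step true  l = ℚ.≤-trans l (ℚ.+-monoˡ-≤ _ (ℚ.p⊓q≤p a 0ℚ))
    step false l = ℚ.≤-trans l (subst ((a ⊓ 0ℚ) + clauseSum c w ≤_) (ℚ.+-identityˡ (clauseSum c w))
      (ℚ.+-monoˡ-≤ (clauseSum c w) (ℚ.p⊓q≤q a 0ℚ)))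

  -- Gates as conjunctions of clauses

  all-singletons : ∀ {k} {P : Subset k → Set} (s : Subset k) →
    (∀ i → i ∈ s → P ⁅ i ⁆) → All P (singletons s)
  all-singletons []          h = []
  all-singletons (true  ∷ s) h =
    h zero here ∷ All.map⁺ (all-singletons s λ i m → h (suc i) (there m))
  all-singletons (false ∷ s) h = All.map⁺ (all-singletons s λ i m → h (suc i) (there m))

  any-singletons : ∀ {k} {P : Subset k → Set} (s : Subset k) i → i ∈ s → P ⁅ i ⁆ → Any P (singletons s)
  any-singletons (true  ∷ s) zero    m         p = Any.here p
  any-singletons (true  ∷ s) (suc i) (there m) p = Any.there (Any.map⁺ (any-singletons s i m p))
  any-singletons (false ∷ s) (suc i) (there m) p = Any.map⁺ (any-singletons s i m p)

  gateValue-true : ∀ {k} (g : Gate k) v → gateValue g v ≡ true →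
    All (λ c → ∃ λ i → i ∈ c × i ∈ v) (clauses g)
  gateValue-true (gate AND s _) v e with s ⊆? v
  ... | yes s⊆v = all-singletons s λ i m → i , x∈⁅x⁆ i , s⊆v m
  gateValue-true (gate OR s _) v e with nonempty? (s ∩ v)
  ... | yes (i , m) = (i , x∈p∩q⁻ s v m) ∷ []

  gateValue-false : ∀ {k} (g : Gate k) v → gateValue g v ≡ false →
    Any (λ c → ∀ i → i ∈ c → i ∉ v) (clauses g)
  gateValue-false (gate AND s _) v e with s ⊆? v
  -- Membership is decidable, so the failing inclusion yields an actual False input; its singleton
  -- is the clause missed by `v`.
  ... | no s⊈v with any? (λ i → (i ∈? s) ×-dec ¬? (i ∈? v))
  ...   | yes (i , i∈s , i∉v) = any-singletons s i i∈s λ j j∈i → subst (_∉ v) (sym (x∈⁅y⁆⇒x≡y i j∈i)) i∉v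
  ...   | no none = contradiction
          (λ {i} i∈s → decidable-stable (i ∈? v) λ i∉v → none (i , i∈s , i∉v)) s⊈v
  gateValue-false (gate OR s _) v e with nonempty? (s ∩ v)
  ... | no empty = Any.here λ i i∈s i∈v → empty (i , x∈p∩q⁺ (i∈s , i∈v))

  ∈⇒true : ∀ {k} {v : Subset k} {i} → i ∈ v → lookup v i ≡ true
  ∈⇒true m = Vec.[]=⇒lookup m

  ∉⇒false : ∀ {k} (v : Subset k) i → i ∉ v → lookup v i ≡ false
  ∉⇒false v i i∉v with lookup v i in e
  ... | true  = contradiction (Vec.lookup⇒[]= i v e) i∉v
  ... | false = refl

  -- The lower bound

  infixr 7 _times_

  -- Repeated addition, so that inductions over a subset add one `q * q` per element.
  _times_ : ℕ → ℚ → ℚ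
  zero  times q = 0ℚ
  suc m times q = q + m times q

  times-nonNeg : ∀ m {q} → 0ℚ ≤ q → 0ℚ ≤ m times q
  times-nonNeg zero    0≤q = ℚ.≤-refl
  times-nonNeg (suc m) 0≤q = ℚ.+-mono-≤ 0≤q (times-nonNeg m 0≤q)

  times-mono-≤ : ∀ {m n q} → 0ℚ ≤ q → m ℕ.≤ n → m times q ≤ n times q
  times-mono-≤ {n = n} 0≤q ℕ.z≤n       = times-nonNeg n 0≤q
  times-mono-≤ {q = q} 0≤q (ℕ.s≤s m≤n) = ℚ.+-monoʳ-≤ q (times-mono-≤ 0≤q m≤n)

  inputWeights : ∀ {n k} → Gates n k → Vec ℚ k → Vec ℚ n
  inputWeights inputs  w       = w
  inputWeights (G ▹ _) (_ ∷ w) = inputWeights G w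

  support : ∀ {n} → Vec ℚ n → Subset n
  support = Vec.map (λ a → does (0ℚ ℚ.≤? a))

  inputs-lower : ∀ {n} q (w : Vec ℚ n) →
    ∣ support w ∣ times (q * q) ≤ total (rowLoss q w) (List.map literals (singletons ⊤))
  inputs-lower q [] = ℚ.≤-refl
  inputs-lower {suc n} q (a ∷ w) = step (0ℚ ℚ.≤? a)
    where
    rest = List.map {A = Subset (suc n)} literals (List.map (false ∷_) (singletons ⊤))

    rest≡ : total (rowLoss q (a ∷ w)) rest
          ≡ total (rowLoss q w) (List.map literals (singletons ⊤))
    rest≡ = total-false∷ q a w (singletons ⊤)

    first≡ : value (literals (true ∷ ⊥)) (a ∷ w) ≡ - a
    first≡ = trans (value-literals (true ∷ ⊥) (a ∷ w))
      (cong -_ (trans (cong (a +_) (clauseSum-⊥ w)) (ℚ.+-identityʳ a)))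

    ih : ∣ support w ∣ times (q * q) ≤ total (rowLoss q (a ∷ w)) rest
    ih = subst (_ ≤_) (sym rest≡) (inputs-lower q w)

    step : (d : Dec (0ℚ ≤ a)) → ∣ does d ∷ support w ∣ times (q * q)
      ≤ reluLoss (value (literals (true ∷ ⊥)) (a ∷ w)) q + total (rowLoss q (a ∷ w)) rest
    step (yes 0≤a) = ℚ.+-mono-≤
      (ℚ.≤-reflexive (sym (trans (cong (λ z → reluLoss z q) first≡)
        (reluLoss-nonPos q (ℚ.neg-antimono-≤ 0≤a))))) ih
    step (no _) = ℚ.≤-trans ih (p≤q+p (reluLoss-nonNeg (value (literals (true ∷ ⊥)) (a ∷ w)) q))

  inputRows-lower : ∀ {n k} (G : Gates n k) q w →
    ∣ support (inputWeights G w) ∣ times (q * q) ≤ total (rowLoss q w) (inputRows G)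
  inputRows-lower inputs  q w       = inputs-lower q w
  inputRows-lower (G ▹ _) q (a ∷ w) = subst (_ ≤_) (sym (total-𝟎∷ q a w (inputRows G)))
    (inputRows-lower G q w)

  -- Induction over the gates. A False gate has a clause of False wires only, whose weights are
  -- negative by induction; with `0 ≤ a` the form of that clause would be at least `u`, against the
  -- bound 1. The same bounds serve at every gate.
  falseWires-neg : ∀ {n k} (G : Gates n k) {u} w → 1ℚ < u →
    All (λ r → u + value r w < 1ℚ) (gateRows G) →
    ∀ i → lookup (values G (support (inputWeights G w))) i ≡ false → lookup w i < 0ℚ
  falseWires-neg inputs w 1<u rows i e with 0ℚ ℚ.≤? lookup w i in d
  ... | no  0≰a = ℚ.≰⇒> 0≰a
  ... | yes 0≤a = case trans (sym e) (trans (Vec.lookup-map i _ w) (cong does d)) of λ ()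
  falseWires-neg (G ▹ g) {u} (a ∷ w) 1<u rows = λ
    { zero    e → ℚ.≰⇒> λ 0≤a →
        All.lookupWith (λ {c} → unsatisfied 0≤a c) clauseRows (gateValue-false g v e)
    ; (suc i) e → below i e
    }
    where
    v = values G (support (inputWeights G w))

    clauseRows : All (λ c → u + value (𝟏 ∷ literals c) (a ∷ w) < 1ℚ) (clauses g)
    clauseRows = All.map⁻ (All.++⁻ˡ (List.map (λ c → 𝟏 ∷ literals c) (clauses g)) rows)

    below : ∀ i → lookup v i ≡ false → lookup w i < 0ℚ
    below = falseWires-neg G w 1<u
      (All.map (λ {r} → subst (λ z → u + z < 1ℚ) (value-𝟎∷ a r w))
        (All.map⁻ (All.++⁻ʳ (List.map (λ c → 𝟏 ∷ literals c) (clauses g)) rows)))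

    unsatisfied : 0ℚ ≤ a → ∀ c → u + value (𝟏 ∷ literals c) (a ∷ w) < 1ℚ → ¬ (∀ i → i ∈ c → i ∉ v)
    unsatisfied 0≤a c l off = <⇒≱ l (ℚ.≤-trans (ℚ.<⇒≤ 1<u) (p≤p+q
      (subst (0ℚ ≤_) (sym (trans (value-𝟏∷ a (literals c) w) (cong (a +_) (value-literals c w))))
        (ℚ.+-mono-≤ 0≤a (ℚ.neg-antimono-≤ (clauseSum-nonPos c w λ i i∈c →
          ℚ.<⇒≤ (below i (∉⇒false v i (off i i∈c)))))))))

  module _ {n k : ℕ} (G : Gates n k) (o : Fin k) (q : ℚ) where

    total-circuitSamples : ∀ u w →
      total (loss (u ∷ w)) (circuitSamples G o q) ≡
        loss (u ∷ w) (outputSample G o q)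
        + (total (λ r → reluLoss (u * 1ℚ + value r w) 0ℚ) (gateRows G)
        + (total (λ r → reluLoss (u * 0ℚ + value r w) q) (inputRows G)
        + (loss (u ∷ w) (unitSample G o q) + 0ℚ)))
    total-circuitSamples u w = cong (loss (u ∷ w) (outputSample G o q) +_)
      (trans (total-++ _ (List.map (sample 𝟏 0ℚ) (gateRows G)) _)
        (cong₂ _+_ (total-map _ _ (gateRows G))
          (trans (total-++ _ (List.map (sample 𝟎 q) (inputRows G)) _)
            (cong (_+ (loss (u ∷ w) (unitSample G o q) + 0ℚ)) (total-map _ _ (inputRows G))))))

    -- Losses are non-negative, so a total below 1 puts every single loss below 1, and
    -- `falseWires-neg` applies.
    small⇒true : ∀ u w → total (loss (u ∷ w)) (circuitSamples G o q) < 1ℚ →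
      lookup (values G (support (inputWeights G w))) o ≡ true
    small⇒true u w small = output-true _ refl
      where
      losses : All (λ p → loss (u ∷ w) p < 1ℚ) (circuitSamples G o q)
      losses = All.map (λ l → ℚ.≤-<-trans l small)
        (all≤total (loss-nonNeg (u ∷ w)) (circuitSamples G o q))

      afterGates : All (λ p → loss (u ∷ w) p < 1ℚ)
        (List.map (sample 𝟎 q) (inputRows G) ++ unitSample G o q ∷ [])
      afterGates = All.++⁻ʳ (List.map (sample 𝟏 0ℚ) (gateRows G)) (All.tail losses)

      1<u : 1ℚ < u
      1<u = subst (1ℚ <_)
        (trans (cong₂ _+_ (ℚ.*-identityʳ u) (value-zeros w)) (ℚ.+-identityʳ u))
        (reluLoss₂-<1 (All.head (All.++⁻ʳ (List.map (sample 𝟎 q) (inputRows G)) afterGates)))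

      scaled : ∀ r → reluLoss (u * 1ℚ + value r w) 0ℚ < 1ℚ → u + value r w < 1ℚ
      scaled r l = subst (λ z → z + value r w < 1ℚ) (ℚ.*-identityʳ u) (reluLoss₀-<1 l)

      output-true : ∀ b → lookup (values G (support (inputWeights G w))) o ≡ b →
        lookup (values G (support (inputWeights G w))) o ≡ true
      output-true true  e = e
      -- A False output has negative weight, which would make the form `u - w_o` of the output
      -- sample exceed 1.
      output-true false e = contradiction
        (ℚ.≤-trans (ℚ.<⇒≤ 1<u) (p≤p+q
          (subst (0ℚ ≤_) (sym (trans (value-literals ⁅ o ⁆ w) (cong -_ (clauseSum-⁅⁆ o w))))
            (ℚ.neg-antimono-≤ (ℚ.<⇒≤ (falseWires-neg G w 1<u
              (All.map (λ {r} → scaled r)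
                (All.map⁻ (All.++⁻ˡ (List.map (sample 𝟏 0ℚ) (gateRows G)) (All.tail losses))))
              o e))))))
        (<⇒≱ (scaled (literals ⁅ o ⁆) (All.head losses)))

    error-lower : ∀ m → m times (q * q) ≤ 1ℚ →
      (∀ x → lookup (values G x) o ≡ true → m ℕ.≤ ∣ x ∣) →
      ∀ w → m times (q * q) ≤ total (loss w) (circuitSamples G o q)
    error-lower m ≤1 least (u ∷ w) with 1ℚ ℚ.≤? total (loss (u ∷ w)) (circuitSamples G o q)
    ... | yes 1≤ = ℚ.≤-trans ≤1 1≤
    ... | no  1≰ = begin
      m times (q * q)
        ≤⟨ times-mono-≤ (square-nonNeg q) (least _ (small⇒true u w (ℚ.≰⇒> 1≰))) ⟩
      ∣ support (inputWeights G w) ∣ times (q * q)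
        ≤⟨ inputRows-lower G q w ⟩
      total (rowLoss q w) (inputRows G)
        ≡⟨ total-cong (λ r → cong (λ z → reluLoss z q) (value-𝟎∷ u r w)) (inputRows G) ⟨
      total (λ r → reluLoss (u * 0ℚ + value r w) q) (inputRows G)
        ≤⟨ p≤p+q (ℚ.+-mono-≤ (loss-nonNeg (u ∷ w) (unitSample G o q)) ℚ.≤-refl) ⟩
      total (λ r → reluLoss (u * 0ℚ + value r w) q) (inputRows G) + (loss (u ∷ w) (unitSample G o q) + 0ℚ)
        ≤⟨ p≤q+p (total-nonNeg (λ r → reluLoss-nonNeg (u * 1ℚ + value r w) 0ℚ) (gateRows G)) ⟩
      total (λ r → reluLoss (u * 1ℚ + value r w) 0ℚ) (gateRows G)
        + (total (λ r → reluLoss (u * 0ℚ + value r w) q) (inputRows G) + (loss (u ∷ w) (unitSample G o q) + 0ℚ))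
        ≤⟨ p≤q+p (loss-nonNeg (u ∷ w) (outputSample G o q)) ⟩
      loss (u ∷ w) (outputSample G o q)
        + (total (λ r → reluLoss (u * 1ℚ + value r w) 0ℚ) (gateRows G)
        + (total (λ r → reluLoss (u * 0ℚ + value r w) q) (inputRows G)
        + (loss (u ∷ w) (unitSample G o q) + 0ℚ)))
        ≡⟨ total-circuitSamples u w ⟨
      total (loss (u ∷ w)) (circuitSamples G o q) ∎
      where open ℚ.≤-Reasoning

  -- The upper bound

  -- Bounds the total size of the negative weights of an `assignment`. A False gate weighs minus the
  -- bound for the earlier wires, less 2 to absorb `u`; hence the doubling.
  magnitude : ∀ {n k} → ℚ → Gates n k → ℚ
  magnitude {n} q inputs  = n times q
  magnitude     q (G ▹ _) = (magnitude q G + 2ℚ) + magnitude q G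

  -- R can be raised for earlier wires until a True wire outweighs the False ones
  -- in every clause of g, because the magnitude of False wires does not depend on R.
  assignment : ∀ {n k} → ℚ → Subset n → Gates n k → ℚ → Vec ℚ k
  assignment q x inputs  R = Vec.map (λ b → if b then R else - q) x
  assignment q x (G ▹ g) R =
    (if gateValue g (values G x) then R else - (magnitude q G + 2ℚ))
    ∷ assignment q x G (R + (magnitude q G + 2ℚ))

  0≤2 : 0ℚ ≤ 2ℚ
  0≤2 = ℚ.nonNegative⁻¹ 2ℚ

  module _ {q : ℚ} (0≤q : 0ℚ ≤ q) {n : ℕ} (x : Subset n) where

    magnitude-nonNeg : ∀ {k} (G : Gates n k) → 0ℚ ≤ magnitude q G
    magnitude-nonNeg inputs  = times-nonNeg n 0≤q
    magnitude-nonNeg (G ▹ _) = ℚ.+-mono-≤ (ℚ.+-mono-≤ (magnitude-nonNeg G) 0≤2) (magnitude-nonNeg G)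

    R≤ : ∀ {k} (G : Gates n k) {R} → R ≤ R + (magnitude q G + 2ℚ)
    R≤ G = p≤p+q (ℚ.+-mono-≤ (magnitude-nonNeg G) 0≤2)

    assignment-true : ∀ {k} (G : Gates n k) R i → lookup (values G x) i ≡ true →
      R ≤ lookup (assignment q x G R) i
    assignment-true inputs R i e = ℚ.≤-reflexive (sym
      (trans (Vec.lookup-map i _ x) (cong (λ b → if b then R else - q) e)))
    assignment-true (G ▹ g) R zero e rewrite e = ℚ.≤-refl
    assignment-true (G ▹ g) R (suc i) e = ℚ.≤-trans (R≤ G) (assignment-true G _ i e)

    negSum-inputs : ∀ {m} {R} → 0ℚ ≤ R → (y : Subset m) →
      - (m times q) ≤ negSum (Vec.map (λ b → if b then R else - q) y)
    negSum-inputs 0≤R [] = ℚ.≤-refl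
    negSum-inputs {suc m} {R} 0≤R (b ∷ y) = subst (_≤ negSum (Vec.map (λ b → if b then R else - q) (b ∷ y)))
      (sym (ℚ.neg-distrib-+ q (m times q)))
      (ℚ.+-mono-≤ (head b) (negSum-inputs 0≤R y))
      where
      head : ∀ b → - q ≤ (if b then R else - q) ⊓ 0ℚ
      head true  = subst (- q ≤_) (sym (ℚ.p≥q⇒p⊓q≡q 0≤R)) (ℚ.neg-antimono-≤ 0≤q)
      head false = ℚ.≤-reflexive (sym (ℚ.p≤q⇒p⊓q≡p (ℚ.neg-antimono-≤ 0≤q)))

    negSum-assignment : ∀ {k} (G : Gates n k) {R} → 0ℚ ≤ R → - magnitude q G ≤ negSum (assignment q x G R)
    negSum-assignment inputs  0≤R = negSum-inputs 0≤R x
    negSum-assignment (G ▹ g) {R} 0≤R = subst (_≤ negSum (assignment q x (G ▹ g) R))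
      (sym (ℚ.neg-distrib-+ (magnitude q G + 2ℚ) (magnitude q G)))
      (ℚ.+-mono-≤ (head (gateValue g (values G x))) (negSum-assignment G (ℚ.≤-trans 0≤R (R≤ G))))
      where
      neg : - (magnitude q G + 2ℚ) ≤ 0ℚ
      neg = ℚ.neg-antimono-≤ (ℚ.+-mono-≤ (magnitude-nonNeg G) 0≤2)

      head : ∀ b → - (magnitude q G + 2ℚ) ≤ (if b then R else - (magnitude q G + 2ℚ)) ⊓ 0ℚ
      head true  = subst (- (magnitude q G + 2ℚ) ≤_) (sym (ℚ.p≥q⇒p⊓q≡q 0≤R)) neg
      head false = ℚ.≤-reflexive (sym (ℚ.p≤q⇒p⊓q≡p neg))

    -- With `B` the magnitude of the earlier wires: a True gate has in each clause a wire of weight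
    -- at least `R + (B + 2)`, and the rest costs at most `B`, which leaves `R + 2`. A False gate
    -- has weight `- (B + 2)`, and no clause sums to less than `- B`.
    gateRows-satisfied : ∀ {k} (G : Gates n k) {R} → 0ℚ ≤ R →
      All (λ r → 2ℚ + value r (assignment q x G R) ≤ 0ℚ) (gateRows G)
    gateRows-satisfied inputs  0≤R = []
    gateRows-satisfied (G ▹ g) {R} 0≤R = All.++⁺
      (All.map⁺ (clauseRows (gateValue g (values G x)) refl))
      (All.map⁺ (All.map (λ {r} → subst (λ z → 2ℚ + z ≤ 0ℚ)
          (sym (value-𝟎∷ (if gateValue g (values G x) then R else - (B + 2ℚ)) r w)))
        (gateRows-satisfied G 0≤R′)))
      where
      B = magnitude q G
      0≤R′ = ℚ.≤-trans 0≤R (R≤ G)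
      w = assignment q x G (R + (B + 2ℚ))

      row : ∀ a c → a + 2ℚ ≤ clauseSum c w → 2ℚ + value (𝟏 ∷ literals c) (a ∷ w) ≤ 0ℚ
      row a c l = subst₂ _≤_
        (trans (solve 3 (λ t a s → (a :+ t) :+ (:- s) := t :+ (a :+ (:- s))) refl 2ℚ a (clauseSum c w))
          (cong (2ℚ +_) (sym (trans (value-𝟏∷ a (literals c) w) (cong (a +_) (value-literals c w))))))
        (ℚ.+-inverseʳ (clauseSum c w))
        (ℚ.+-monoˡ-≤ (- clauseSum c w) l)

      clauseRows : ∀ b → gateValue g (values G x) ≡ b →
        All (λ c → 2ℚ + value (𝟏 ∷ literals c) ((if b then R else - (B + 2ℚ)) ∷ w) ≤ 0ℚ) (clauses g)
      clauseRows true e = All.map (λ {c} (i , i∈c , i∈v) → row R c (ℚ.≤-trans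
        (ℚ.≤-trans
          (ℚ.≤-reflexive (solve 3 (λ r b t → r :+ t := (r :+ (b :+ t)) :+ (:- b)) refl R B 2ℚ))
          (ℚ.+-mono-≤ (assignment-true G _ i (∈⇒true i∈v)) (negSum-assignment G 0≤R′)))
        (lookup+negSum≤clauseSum c w i i∈c))) (gateValue-true g (values G x) e)
      clauseRows false e = All.universal (λ c → row (- (B + 2ℚ)) c (ℚ.≤-trans
        (ℚ.≤-trans
          (ℚ.≤-reflexive (solve 2 (λ b t → :- (b :+ t) :+ t := :- b) refl B 2ℚ))
          (negSum-assignment G 0≤R′))
        (negSum≤clauseSum c w))) (clauses g)

    inputs-attained : ∀ {m} {R} → 0ℚ ≤ R → (y : Subset m) →
      total (λ r → reluLoss (value r (Vec.map (λ b → if b then R else - q) y)) q)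
        (List.map literals (singletons ⊤)) ≡ ∣ y ∣ times (q * q)
    inputs-attained 0≤R [] = refl
    inputs-attained {suc m} {R} 0≤R (b ∷ y) = trans (cong₂ _+_ (cong (λ z → reluLoss z q) first≡) rest≡) (step b)
      where
      a = if b then R else - q
      w = Vec.map (λ b → if b then R else - q) y

      first≡ : value (literals (true ∷ ⊥)) (a ∷ w) ≡ - a
      first≡ = trans (value-literals (true ∷ ⊥) (a ∷ w))
        (cong -_ (trans (cong (a +_) (clauseSum-⊥ w)) (ℚ.+-identityʳ a)))

      rest≡ : total (rowLoss q (a ∷ w))
        (List.map literals (List.map (false ∷_) (singletons ⊤))) ≡ ∣ y ∣ times (q * q)
      rest≡ = trans (total-false∷ q a w (singletons ⊤)) (inputs-attained 0≤R y)

      step : ∀ b → reluLoss (- (if b then R else - q)) q + ∣ y ∣ times (q * q) ≡ ∣ b ∷ y ∣ times (q * q)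
      step true  = cong (_+ ∣ y ∣ times (q * q)) (reluLoss-nonPos q (ℚ.neg-antimono-≤ 0≤R))
      step false = trans
        (cong (_+ ∣ y ∣ times (q * q)) (reluLoss-self 0≤q (solve 1 (λ q → :- (:- q) := q) refl q)))
        (ℚ.+-identityˡ (∣ y ∣ times (q * q)))

    inputRows-attained : ∀ {k} (G : Gates n k) {R} → 0ℚ ≤ R →
      total (λ r → reluLoss (value r (assignment q x G R)) q) (inputRows G) ≡ ∣ x ∣ times (q * q)
    inputRows-attained inputs  0≤R = inputs-attained 0≤R x
    inputRows-attained (G ▹ g) 0≤R =
      trans (total-𝟎∷ q _ _ (inputRows G)) (inputRows-attained G (ℚ.≤-trans 0≤R (R≤ G)))

    error-attained : ∀ {k} (G : Gates n k) o → lookup (values G x) o ≡ true →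
      total (loss (2ℚ ∷ assignment q x G 2ℚ)) (circuitSamples G o q) ≡ ∣ x ∣ times (q * q)
    error-attained G o e = begin
      total (loss (2ℚ ∷ w)) (circuitSamples G o q)
        ≡⟨ total-circuitSamples G o q 2ℚ w ⟩
      loss (2ℚ ∷ w) (outputSample G o q)
        + (total (λ r → reluLoss (2ℚ * 1ℚ + value r w) 0ℚ) (gateRows G)
        + (total (λ r → reluLoss (2ℚ * 0ℚ + value r w) q) (inputRows G)
        + (loss (2ℚ ∷ w) (unitSample G o q) + 0ℚ)))
        ≡⟨ cong₂ _+_ output≡ (cong₂ _+_ gates≡ (cong₂ _+_ inputs≡ (cong (_+ 0ℚ) unit≡))) ⟩
      0ℚ + (0ℚ + (∣ x ∣ times (q * q) + (0ℚ + 0ℚ)))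
        ≡⟨ trans (ℚ.+-identityˡ _) (trans (ℚ.+-identityˡ _) (ℚ.+-identityʳ _)) ⟩
      ∣ x ∣ times (q * q) ∎
      where
      open ≡-Reasoning
      w = assignment q x G 2ℚ

      output≡ : loss (2ℚ ∷ w) (outputSample G o q) ≡ 0ℚ
      output≡ = reluLoss₀-≡0 (subst (2ℚ * 1ℚ + value (literals ⁅ o ⁆) w ≤_) (ℚ.+-inverseʳ 2ℚ)
        (ℚ.+-mono-≤ (ℚ.≤-reflexive (ℚ.*-identityʳ 2ℚ))
          (subst (_≤ - 2ℚ) (sym (trans (value-literals ⁅ o ⁆ w) (cong -_ (clauseSum-⁅⁆ o w))))
            (ℚ.neg-antimono-≤ (assignment-true G 2ℚ o e)))))

      gates≡ : total (λ r → reluLoss (2ℚ * 1ℚ + value r w) 0ℚ) (gateRows G) ≡ 0ℚ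
      gates≡ = total-zero (All.map (λ {r} l → reluLoss₀-≡0
        (subst (λ z → z + value r w ≤ 0ℚ) (sym (ℚ.*-identityʳ 2ℚ)) l)) (gateRows-satisfied G 0≤2))

      inputs≡ : total (λ r → reluLoss (2ℚ * 0ℚ + value r w) q) (inputRows G) ≡ ∣ x ∣ times (q * q)
      inputs≡ = trans (total-cong (λ r → cong (λ z → reluLoss z q) (value-𝟎∷ 2ℚ r w)) (inputRows G))
        (inputRows-attained G 0≤2)

      unit≡ : loss (2ℚ ∷ w) (unitSample G o q) ≡ 0ℚ
      unit≡ = reluLoss-self 0≤2 (cong (2ℚ * 1ℚ +_) (value-zeros w))

  -- The value of the minimum

  -- Proved on unnormalised fractions, where equality is cross-multiplication and no common factors
  -- are cancelled.
  times-reciprocal : ∀ m k →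
    k times (reciprocal (suc m) * reciprocal (suc m)) ≡ (ℤ.+ k) / (suc m ℕ.* suc m)
  times-reciprocal m k = ℚ.toℚᵘ-injective (ℚᵘ.≃-trans (go k)
    (ℚᵘ.≃-sym (ℚ.toℚᵘ-fromℚᵘ (ℚᵘ.mkℚᵘ (ℤ.+ k) d))))
    where
    -- Denominators are stored minus one: `suc d` computes to `suc m ℕ.* suc m`.
    d = m ℕ.+ m ℕ.* suc m
    q = reciprocal (suc m) * reciprocal (suc m)

    go : ∀ k → ℚ.toℚᵘ (k times q) ℚᵘ.≃ ℚᵘ.mkℚᵘ (ℤ.+ k) d
    go zero    = ℚᵘ.*≡* refl
    go (suc k) = ℚᵘ.≃-trans (ℚ.toℚᵘ-homo-+ q (k times q))
      (ℚᵘ.≃-trans (ℚᵘ.+-cong (ℚ.toℚᵘ-homo-* (reciprocal (suc m)) (reciprocal (suc m))) (go k))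
        (ℚᵘ.*≡* (ℤsolve 2 (λ k d →
            (con (ℤ.+ 1) ∙ d ⊕ k ∙ d) ∙ d ⊜ (con (ℤ.+ 1) ⊕ k) ∙ (d ∙ d)) refl (ℤ.+ k) (ℤ.+ suc d))))
      where
      open ℤ.+-*-Solver using (con) renaming (solve to ℤsolve; _:=_ to _⊜_; _:+_ to _⊕_; _:*_ to _∙_)

  times-reciprocal-≤1 : ∀ m k → k ℕ.≤ suc m ℕ.* suc m →
    k times (reciprocal (suc m) * reciprocal (suc m)) ≤ 1ℚ
  times-reciprocal-≤1 m k k≤ = subst (_≤ 1ℚ) (sym (times-reciprocal m k))
    (ℚ.toℚᵘ-cancel-≤ (ℚᵘ.≤-respˡ-≃ (ℚᵘ.≃-sym (ℚ.toℚᵘ-fromℚᵘ (ℚᵘ.mkℚᵘ (ℤ.+ k) (m ℕ.+ m ℕ.* suc m))))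
      (ℚᵘ.*≤* (subst₂ ℤ._≤_ (sym (ℤ.*-identityʳ (ℤ.+ k))) (sym (ℤ.*-identityˡ _)) (ℤ.+≤+ k≤)))))

  #inputs≤#wires : ∀ {n k} → Gates n k → n ℕ.≤ k
  #inputs≤#wires inputs  = ℕ.≤-refl
  #inputs≤#wires (G ▹ _) = ℕ.m≤n⇒m≤1+n (#inputs≤#wires G)

  size≢0 : ∀ C → ℕ.NonZero (10 ℕ.* size C)
  size≢0 C = ℕ.m*n≢0 10 (size C) {{_}} {{nonZeroIndex (output C)}}

  targetScale≢0 : ∀ ℓ C → ℕ.NonZero (targetScale ℓ C)
  targetScale≢0 ℓ C = ℕ.m^n≢0 (10 ℕ.* size C) (suc ℓ) {{size≢0 C}}

  scale-square : ∀ ℓ C →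
    (10 ℕ.* size C) ℕ.^ (2 ℕ.* ℓ ℕ.+ 2) ≡ targetScale ℓ C ℕ.* targetScale ℓ C
  scale-square ℓ C = trans
    (cong ((10 ℕ.* size C) ℕ.^_) (ℕsolve 1 (λ ℓ → con 2 ∙ ℓ ⊕ con 2 ⊜ (con 1 ⊕ ℓ) ⊕ (con 1 ⊕ ℓ)) refl ℓ))
    (ℕ.^-distribˡ-+-* (10 ℕ.* size C) (suc ℓ) (suc ℓ))
    where
    open ℕ.+-*-Solver using (con) renaming (solve to ℕsolve; _:=_ to _⊜_; _:+_ to _⊕_; _:*_ to _∙_)

  size≤targetScale : ∀ ℓ C → size C ℕ.≤ targetScale ℓ C
  size≤targetScale ℓ C = begin
    size C                     ≤⟨ ℕ.m≤n*m (size C) 10 ⟩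
    10 ℕ.* size C              ≡⟨ ℕ.^-identityʳ _ ⟨
    (10 ℕ.* size C) ℕ.^ 1      ≤⟨ ℕ.^-monoʳ-≤ (10 ℕ.* size C) {{size≢0 C}} {1} {suc ℓ} (ℕ.s≤s ℕ.z≤n) ⟩
    (10 ℕ.* size C) ℕ.^ suc ℓ  ∎
    where open ℕ.≤-Reasoning

  circuitSamples-isMin : ∀ {n k} (G : Gates n k) o m j →
    (∃ λ x → lookup (values G x) o ≡ true × ∣ x ∣ ≡ j) →
    (∀ x → lookup (values G x) o ≡ true → j ℕ.≤ ∣ x ∣) → k ℕ.≤ suc m →
    IsMin (error (record { points = circuitSamples G o (reciprocal (suc m)) }))
      (fromℚ ((ℤ.+ j) / (suc m ℕ.* suc m)))
  circuitSamples-isMin {n} {k} G o m j (x , sat , ∣x∣≡j) least k≤m =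
    subst (λ v → IsMin (error S) (fromℚ v)) (times-reciprocal m j)
      (isMin S (j times (q * q))
        ((2ℚ ∷ assignment q x G 2ℚ) ,
          trans (error-attained 0≤q x G o sat) (cong (_times (q * q)) ∣x∣≡j))
        (error-lower G o q j (times-reciprocal-≤1 m j j≤) least))
    where
    q = reciprocal (suc m)
    S = record { points = circuitSamples G o q }

    0≤q : 0ℚ ≤ q
    0≤q = ℚ.nonNegative⁻¹ q

    -- A satisfying set has at most as many elements as there are wires, which keeps the claimed
    -- minimum at most 1, as `error-lower` requires.
    j≤ : j ℕ.≤ suc m ℕ.* suc m
    j≤ = begin
      j                  ≡⟨ ∣x∣≡j ⟨
      ∣ x ∣              ≤⟨ ∣p∣≤n x ⟩
      n                  ≤⟨ #inputs≤#wires G ⟩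
      k                  ≤⟨ k≤m ⟩
      suc m              ≤⟨ ℕ.m≤m*n (suc m) (suc m) ⟩
      suc m ℕ.* suc m    ∎
      where open ℕ.≤-Reasoning

  reduction-isMin : ∀ ℓ C → IsMin (error (reduction ℓ C))
    (fromℚ (_/_ (ℤ.+ opt C) ((10 ℕ.* size C) ℕ.^ (2 ℕ.* ℓ ℕ.+ 2)) {{scale≢0 C ℓ}}))
  reduction-isMin ℓ C = subst (λ v → IsMin (error (reduction ℓ C)) (fromℚ v))
    (ℚ./-cong {ℤ.+ opt C} {{_}} {{scale≢0 C ℓ}} refl
      (trans (cong₂ ℕ._*_ M≡ M≡) (sym (scale-square ℓ C))))
    (circuitSamples-isMin (gates C) (output C) (ℕ.pred M) (opt C)
      (proj₁ (proj₂ (opt-exists C))) (proj₂ (proj₂ (opt-exists C)))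
      (subst (size C ℕ.≤_) (sym M≡) (size≤targetScale ℓ C)))
    where
    M = targetScale ℓ C

    M≡ : suc (ℕ.pred M) ≡ M
    M≡ = ℕ.suc-pred M {{targetScale≢0 ℓ C}}

-- A stack program that computes the samples in polynomial time

module Machine where

  open Optimum
  open import Data.Nat.Base using (_+_; _*_; _^_; _≤_; z≤n; s≤s)
  open import Data.List.Base using (_ʳ++_; reverse; concatMap; length; replicate; [_])

  -- Running programs within a time bound

  infix 3 _⊢_⇒_within_

  _⊢_⇒_within_ : ∀ {k} → Program k → State k → State k → ℕ → Set
  P ⊢ s ⇒ s′ within T = ∃ λ t → Runs P s t s′ × t ≤ T

  module _ {k : ℕ} where

    private variable
      P Q : Program k
      s s′ s″ : State k
      T U : ℕ
      b : Maybe Symbol → Bool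
      i : Fin k

    weaken : T ≤ U → P ⊢ s ⇒ s′ within T → P ⊢ s ⇒ s′ within U
    weaken T≤U (t , r , t≤) = t , r , ℕ.≤-trans t≤ T≤U

    infixr 4 _then_

    _then_ : P ⊢ s ⇒ s′ within T → Q ⊢ s′ ⇒ s″ within U → (P ⨾ Q) ⊢ s ⇒ s″ within (T + U)
    (t , r , t≤) then (u , q , u≤) = t + u , comp r q , ℕ.+-mono-≤ t≤ u≤

    push-runs : ∀ {a} → push i a ⊢ s ⇒ s [ i ]%= (a ∷_) within 1
    push-runs = 1 , push , ℕ.≤-refl

    pop-runs : pop i ⊢ s ⇒ s [ i ]%= List.drop 1 within 1
    pop-runs = 1 , pop , ℕ.≤-refl

    then-branch : b (top s i) ≡ true → P ⊢ s ⇒ s′ within T →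
      if b on i then P else Q ⊢ s ⇒ s′ within suc T
    then-branch e (t , r , t≤) = suc t , if-true e r , s≤s t≤

    else-branch : b (top s i) ≡ false → Q ⊢ s ⇒ s′ within T →
      if b on i then P else Q ⊢ s ⇒ s′ within suc T
    else-branch e (t , r , t≤) = suc t , if-false e r , s≤s t≤

    loop-step : b (top s i) ≡ true → P ⊢ s ⇒ s′ within T → while b on i loop P ⊢ s′ ⇒ s″ within U →
      while b on i loop P ⊢ s ⇒ s″ within suc (T + U)
    loop-step e (t , r , t≤) (u , q , u≤) = suc (t + u) , while-true e r q , s≤s (ℕ.+-mono-≤ t≤ u≤)

    loop-stop : b (top s i) ≡ false → while b on i loop P ⊢ s ⇒ s within 1
    loop-stop e = 1 , while-false e , ℕ.≤-refl

  -- Loops and transfers between stacks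

  loopTime : ℕ → ℕ → ℕ
  loopTime T zero    = 1
  loopTime T (suc n) = suc (T + loopTime T n)

  loopTime-mono : ∀ {T U m n} → T ≤ U → m ≤ n → loopTime T m ≤ loopTime U n
  loopTime-mono {n = zero}  T≤U z≤n       = ℕ.≤-refl
  loopTime-mono {n = suc n} T≤U z≤n       = s≤s z≤n
  loopTime-mono             T≤U (s≤s m≤n) = s≤s (ℕ.+-mono-≤ T≤U (loopTime-mono T≤U m≤n))

  -- The first symbol is pushed first, so the word ends up reversed; hence `_ʳ++_` throughout the
  -- descriptions of written stacks.
  emit : ∀ {k} → Fin k → List Symbol → Program k
  emit i []      = skip
  emit i (a ∷ w) = push i a ⨾ emit i w

  emit-runs : ∀ {k} (i : Fin k) w {s} → emit i w ⊢ s ⇒ s [ i ]%= (w ʳ++_) within suc (length w)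
  emit-runs i []      {s} = 1 , subst (Runs skip s 1) (sym (Vec.updateAt-id i s)) skip , ℕ.≤-refl
  emit-runs i (a ∷ w) {s} = subst (emit i (a ∷ w) ⊢ s ⇒_within suc (length (a ∷ w)))
    (Vec.updateAt-updateAt i s) (push-runs then emit-runs i w)

  is : Symbol → Maybe Symbol → Bool
  is 𝟎 (just 𝟎) = true
  is 𝟏 (just 𝟏) = true
  is ♯ (just ♯) = true
  is _ _        = false

  isBit : Maybe Symbol → Bool
  isBit (just 𝟎) = true
  isBit (just 𝟏) = true
  isBit _        = false

  isCode : Maybe Symbol → Bool
  isCode (just 𝟎) = true
  isCode (just ♯) = true
  isCode _        = false

  dispatch : ∀ {k} → Fin k → (Symbol → Program k) → Program k
  dispatch i f = if is 𝟎 on i then f 𝟎 else (if is 𝟏 on i then f 𝟏 else f ♯)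

  dispatch-runs : ∀ {k} {i : Fin k} f {s s′ T} a → top s i ≡ just a →
    f a ⊢ s ⇒ s′ within T → dispatch i f ⊢ s ⇒ s′ within suc (suc T)
  dispatch-runs f 𝟎 e r = weaken (ℕ.n≤1+n _) (then-branch (cong (is 𝟎) e) r)
  dispatch-runs f 𝟏 e r = else-branch (cong (is 𝟎) e) (then-branch (cong (is 𝟏) e) r)
  dispatch-runs f ♯ e r = else-branch (cong (is 𝟎) e) (else-branch (cong (is 𝟏) e) r)

  -- Moves the symbols at the top of stack X satisfying b: each symbol a makes
  -- p a be written to Y and q a to Z.
  pour : ∀ {k} → (Maybe Symbol → Bool) → (X Y : Fin k) → (Symbol → List Symbol) →
         Fin k → (Symbol → List Symbol) → Program k
  pour b X Y p Z q = while b on X loop dispatch X (λ a → pop X ⨾ emit Y (p a) ⨾ emit Z (q a))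

  -- Per symbol: 2 tests in `dispatch`, 1 pop, and two emissions of at most 10 symbols at 11 steps
  -- each. The longest image used is that of `ten`.
  pourTime : ℕ → ℕ
  pourTime = loopTime 25

  module _ {k : ℕ} (X Y Z : Fin k)
    {distinct : True (¬? (X Fin.≟ Y) ×-dec ¬? (X Fin.≟ Z) ×-dec ¬? (Y Fin.≟ Z))} (s : State k) where

    private
      X≢Y = proj₁ (toWitness distinct)
      X≢Z = proj₁ (proj₂ (toWitness distinct))
      Y≢Z = proj₂ (proj₂ (toWitness distinct))

      -- For concrete stacks these updates compute to a `stacks` term, so the lemmas below apply to
      -- machine states directly.
      σ : List Symbol → List Symbol → List Symbol → State k
      σ x y z = s [ X ]≔ x [ Y ]≔ y [ Z ]≔ z

      update-Z : ∀ {x y z} f → σ x y z [ Z ]%= f ≡ σ x y (f z)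
      update-Z f = Vec.updateAt-updateAt Z _

      update-Y : ∀ {x y z} f → σ x y z [ Y ]%= f ≡ σ x (f y) z
      update-Y {z = z} f = trans (Vec.updateAt-commutes Y Z Y≢Z _)
        (cong (_[ Z ]≔ z) (Vec.updateAt-updateAt Y _))

      update-X : ∀ {x y z} f → σ x y z [ X ]%= f ≡ σ (f x) y z
      update-X {y = y} {z} f = trans (Vec.updateAt-commutes X Z X≢Z _)
        (cong (_[ Z ]≔ z) (trans (Vec.updateAt-commutes X Y X≢Y _)
          (cong (_[ Y ]≔ y) (Vec.updateAt-updateAt X s))))

      lookup-X : ∀ {x y z} → lookup (σ x y z) X ≡ x
      lookup-X {x} {y} {z} = trans (Vec.lookup∘update′ X≢Z (s [ X ]≔ x [ Y ]≔ y) z)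
        (trans (Vec.lookup∘update′ X≢Y (s [ X ]≔ x) y) (Vec.lookup∘update X s x))

    -- The loop halts where `rest` begins. The images are given up to equations, so that each use
    -- can name them in simplified form.
    pour-runs : ∀ {b p q} → (∀ a → length (p a) ≤ 10) → (∀ a → length (q a) ≤ 10) →
      ∀ {xs rest ys zs ps qs} → All (λ a → b (just a) ≡ true) xs → b (List.head rest) ≡ false →
      concatMap p xs ≡ ps → concatMap q xs ≡ qs →
      pour b X Y p Z q ⊢ σ (xs ++ rest) ys zs ⇒ σ rest (ps ʳ++ ys) (qs ʳ++ zs) within pourTime (length xs)
    pour-runs {b} p≤ q≤ {[]} {rest} {ys} {zs} [] stop refl refl =
      loop-stop (trans (cong (b ∘ List.head) (lookup-X {rest} {ys} {zs})) stop)
    pour-runs {b} {p} {q} p≤ q≤ {a ∷ xs} {rest} {ys} {zs} (ba ∷ bs) stop refl refl = loop-step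
      (trans (cong (b ∘ List.head) (lookup-X {a ∷ xs ++ rest} {ys} {zs})) ba)
      (dispatch-runs (λ a → pop X ⨾ emit Y (p a) ⨾ emit Z (q a)) a (cong List.head (lookup-X {a ∷ xs ++ rest} {ys} {zs}))
        (subst (λ s′ → pop X ⨾ emit Y (p a) ⨾ emit Z (q a) ⊢ σ (a ∷ xs ++ rest) ys zs ⇒ s′ within 23)
          (trans (cong (λ s → s [ Y ]%= (p a ʳ++_) [ Z ]%= (q a ʳ++_)) (update-X (List.drop 1)))
            (trans (cong (_[ Z ]%= (q a ʳ++_)) (update-Y (p a ʳ++_))) (update-Z (q a ʳ++_))))
          (weaken (s≤s (ℕ.+-mono-≤ (s≤s (p≤ a)) (s≤s (q≤ a))))
            (pop-runs then emit-runs Y (p a) then emit-runs Z (q a)))))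
      (subst₂ (λ ys zs → pour b X Y p Z q ⊢ σ (xs ++ rest) _ _ ⇒ σ rest ys zs within pourTime (length xs))
        (sym (List.++-ʳ++ (p a))) (sym (List.++-ʳ++ (q a)))
        (pour-runs p≤ q≤ bs stop refl refl))

    drain-runs : ∀ {p q} → (∀ a → length (p a) ≤ 10) → (∀ a → length (q a) ≤ 10) →
      ∀ xs {ys zs ps qs} → concatMap p xs ≡ ps → concatMap q xs ≡ qs →
      pour is-just X Y p Z q ⊢ σ xs ys zs ⇒ σ [] (ps ʳ++ ys) (qs ʳ++ zs) within pourTime (length xs)
    drain-runs {p} {q} p≤ q≤ xs {ys} {zs} {ps} {qs} e f =
      subst (λ l → pour is-just X Y p Z q ⊢ σ l ys zs ⇒ σ [] (ps ʳ++ ys) (qs ʳ++ zs) within pourTime (length xs))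
        (List.++-identityʳ xs) (pour-runs p≤ q≤ (All.universal (λ _ → refl) xs) refl e f)

  -- The machine

  -- `I` is the input, `O` the output in reverse, `T` scratch space, and `K` the number of wires in
  -- unary. `U` and `V` hold unary products; `V` also serves as a dummy target of pours that write
  -- nothing there.
  stacks : (i o a t k u v y : List Symbol) → State 8
  stacks i o a t k u v y = i ∷ o ∷ a ∷ t ∷ k ∷ u ∷ v ∷ y ∷ []

  pattern I = zero
  pattern O = suc zero
  pattern A = suc (suc zero)
  pattern T = suc (suc (suc zero))
  pattern K = suc (suc (suc (suc zero)))
  pattern U = suc (suc (suc (suc (suc zero))))
  pattern V = suc (suc (suc (suc (suc (suc zero)))))
  pattern Y = suc (suc (suc (suc (suc (suc (suc zero))))))

  Machine : Set
  Machine = Program 8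

  none : Symbol → List Symbol
  none _ = []

  one : Symbol → List Symbol
  one _ = 𝟏 ∷ []

  concatMap-none : ∀ xs → concatMap none xs ≡ []
  concatMap-none []       = refl
  concatMap-none (_ ∷ xs) = concatMap-none xs

  short : ∀ {m n} {m≤n : True (m ℕ.≤? n)} → m ≤ n
  short {m≤n = m≤n} = toWitness m≤n

  digits : Symbol → List Symbol
  digits a = encodeℚ (coefficient a)

  digits≤ : ∀ a → length (digits a) ≤ 10
  digits≤ 𝟎 = short
  digits≤ 𝟏 = short
  digits≤ ♯ = short

  -- Stack A holds the coefficients of a row in reverse, and stack Y the
  -- encoding of its target.
  showRow showTarget : Machine
  showRow = pour is-just A T [_] V none ⨾ pour is-just T A [_] O digits
  showTarget = pour is-just Y T [_] O [_] ⨾ pour is-just T Y [_] V none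

  -- One encoded sample: `h` is the list marker followed by the coefficient of the extra weight, `p`
  -- the wire coefficients and `w` the encoded target.
  rowWord : List Symbol → List Symbol → List Symbol → List Symbol
  rowWord h w p = h ++ concatMap digits p ++ w

  pourTime₂ : ℕ → ℕ
  pourTime₂ n = pourTime n + pourTime n

  showRow-runs : ∀ {i o k u v y} p →
    showRow ⊢ stacks i o (reverse p) [] k u v y ⇒
      stacks i (concatMap digits p ʳ++ o) (reverse p) [] k u v y within pourTime₂ (length p)
  showRow-runs {i} {o} {k} {u} {v} {y} p =
    subst (λ n → pour is-just A T [_] V none ⊢ stacks i o (reverse p) [] k u v y ⇒
                   stacks i o [] p k u v y within pourTime n) (List.length-reverse p)
      (subst (λ t → pour is-just A T [_] V none ⊢ stacks i o (reverse p) [] k u v y ⇒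
                   stacks i o [] t k u v y within pourTime (length (reverse p))) (List.reverse-involutive p)
        (drain-runs A T V (stacks i o [] [] k u v y) (λ _ → short) (λ _ → short) (reverse p)
          (List.concatMap-pure (reverse p)) (concatMap-none (reverse p))))
    then drain-runs T A O (stacks i o [] [] k u v y) (λ _ → short) digits≤ p (List.concatMap-pure p) refl

  showTarget-runs : ∀ {i o a k u v} w →
    showTarget ⊢ stacks i o a [] k u v w ⇒ stacks i (w ʳ++ o) a [] k u v w within pourTime₂ (length w)
  showTarget-runs {i} {o} {a} {k} {u} {v} w =
    drain-runs Y T O (stacks i o a [] k u v []) (λ _ → short) (λ _ → short) w
      (List.concatMap-pure w) (List.concatMap-pure w)
    then subst₂ (λ n y → pour is-just T Y [_] V none ⊢ stacks i (w ʳ++ o) a (reverse w) k u v [] ⇒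
                           stacks i (w ʳ++ o) a [] k u v y within pourTime n)
      (List.length-reverse w) (List.reverse-involutive w)
      (drain-runs T Y V (stacks i (w ʳ++ o) a [] k u v []) (λ _ → short) (λ _ → short) (reverse w)
        (List.concatMap-pure (reverse w)) (concatMap-none (reverse w)))

  writeRow : List Symbol → Machine
  writeRow h = emit O h ⨾ showRow ⨾ showTarget

  ʳ++-++₃ : ∀ (xs ys zs o : List Symbol) → zs ʳ++ ys ʳ++ xs ʳ++ o ≡ (xs ++ ys ++ zs) ʳ++ o
  ʳ++-++₃ xs ys zs o = sym (trans (List.++-ʳ++ xs) (List.++-ʳ++ ys))

  pourTime₄ : ℕ → ℕ
  pourTime₄ M = pourTime₂ M + pourTime₂ M

  -- 7 pays for emitting a head of at most 6 symbols, the length of `unitHead`.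
  rowTime : ℕ → ℕ
  rowTime M = 7 + pourTime₄ M

  pourTime₂-mono : ∀ {m n} → m ≤ n → pourTime₂ m ≤ pourTime₂ n
  pourTime₂-mono m≤n = ℕ.+-mono-≤ (loopTime-mono (ℕ.≤-refl {25}) m≤n) (loopTime-mono (ℕ.≤-refl {25}) m≤n)

  writeRow-runs : ∀ {M i o k u v} h w p → length h ≤ 6 → length w ≤ M → length p ≤ M →
    writeRow h ⊢ stacks i o (reverse p) [] k u v w ⇒
      stacks i (rowWord h w p ʳ++ o) (reverse p) [] k u v w within rowTime M
  writeRow-runs {M} {i} {o} {k} {u} {v} h w p h≤ w≤ p≤ =
    subst (λ o′ → writeRow h ⊢ stacks i o (reverse p) [] k u v w ⇒
                    stacks i o′ (reverse p) [] k u v w within rowTime M)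
      (ʳ++-++₃ h (concatMap digits p) w o)
      (weaken (ℕ.+-mono-≤ (s≤s h≤) (ℕ.+-mono-≤ (pourTime₂-mono p≤) (pourTime₂-mono w≤)))
        (emit-runs O h then showRow-runs p then showTarget-runs w))

  -- Rows of singleton clauses

  bit : Bool → Symbol
  bit b = if b then 𝟏 else 𝟎

  bits : ∀ {k} → Subset k → List Symbol
  bits s = List.map bit (toList s)

  length-bits : ∀ {k} (s : Subset k) → length (bits s) ≡ k
  length-bits s = trans (List.length-map bit (toList s)) (Vec.length-toList s)

  bits-areBits : ∀ {k} (s : Subset k) → All (λ a → isBit (just a) ≡ true) (bits s)
  bits-areBits []          = []
  bits-areBits (true  ∷ s) = refl ∷ bits-areBits s
  bits-areBits (false ∷ s) = refl ∷ bits-areBits s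

  zeros : ℕ → List Symbol
  zeros n = replicate n 𝟎

  -- The bits after the current one are only counted: each is set aside while a coefficient 0 is
  -- written for it, and all are restored because later rows still have to read them.
  writeSingleton : List Symbol → Machine
  writeSingleton h = emit O h ⨾ showRow ⨾ pop I ⨾ emit O (digits ♯)
    ⨾ pour isBit I T [_] O (λ _ → digits 𝟎) ⨾ pour is-just T I [_] V none ⨾ showTarget

  -- The conditional binds tighter than `_⨾_`, so `push A 𝟎` follows both branches: once passed, a
  -- wire has coefficient 0 in all later rows.
  singletonStep : List Symbol → Machine
  singletonStep h = if is 𝟏 on I then writeSingleton h else pop I ⨾ push A 𝟎

  writeSingletons : List Symbol → Machine
  writeSingletons h = while isBit on I loop singletonStep h

  literalWords : ∀ {k} → List Symbol → List Symbol → List Symbol → List (Subset k) → List Symbol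
  literalWords h w p cs = concatMap (λ c → rowWord h w (p ++ toList (literals c))) cs

  -- Matches the recursion of `singletons` with the machine's moving a passed wire into the prefix.
  literalWords-false∷ : ∀ {k} h w p (cs : List (Subset k)) →
    literalWords h w p (List.map (false ∷_) cs) ≡ literalWords h w (p ++ 𝟎 ∷ []) cs
  literalWords-false∷ h w p cs = trans (List.concatMap-map _ (false ∷_) cs)
    (List.concatMap-cong (λ c → cong (rowWord h w) (sym (List.++-assoc p (𝟎 ∷ []) (toList (literals c))))) cs)

  concatMap-zeros : ∀ {k} (s : Subset k) →
    concatMap (λ _ → digits 𝟎) (bits s) ≡ concatMap digits (toList (literals (Vec.replicate k false)))
  concatMap-zeros []      = refl
  concatMap-zeros (_ ∷ s) = cong (digits 𝟎 ++_) (concatMap-zeros s)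

  writeSingletonTime : ℕ → ℕ
  writeSingletonTime M = 7 + (pourTime₂ M + (7 + (pourTime M + (pourTime M + pourTime₂ M))))

  reverse-∷ʳ : ∀ (p : List Symbol) a → reverse (p ++ a ∷ []) ≡ a ∷ reverse p
  reverse-∷ʳ p a = List.reverse-++ p (a ∷ [])

  pourTime-mono : ∀ {m n} → m ≤ n → pourTime m ≤ pourTime n
  pourTime-mono = loopTime-mono (ℕ.≤-refl {25})

  writeSingleton-runs : ∀ {M n r o k u v} h w p (s : Subset n) → length h ≤ 6 → length w ≤ M →
    length p ≤ M → n ≤ M →
    writeSingleton h ⊢ stacks (𝟏 ∷ bits s ++ ♯ ∷ r) o (reverse p) [] k u v w ⇒
      stacks (bits s ++ ♯ ∷ r) (rowWord h w (p ++ ♯ ∷ toList (literals (Vec.replicate n false))) ʳ++ o)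
        (reverse p) [] k u v w
      within writeSingletonTime M
  writeSingleton-runs {M} {n} {r} {o} {k} {u} {v} h w p s h≤ w≤ p≤ n≤ =
    subst (λ o′ → writeSingleton h ⊢ stacks (𝟏 ∷ bits s ++ ♯ ∷ r) o (reverse p) [] k u v w ⇒
                    stacks (bits s ++ ♯ ∷ r) o′ (reverse p) [] k u v w within writeSingletonTime M)
      word≡
      (weaken (ℕ.+-mono-≤ (s≤s h≤) (ℕ.+-mono-≤ (pourTime₂-mono p≤)
          (s≤s (ℕ.+-mono-≤ (short {m = suc (length (digits ♯))} {n = 6})
            (ℕ.+-mono-≤ (pourTime-mono bits≤) (ℕ.+-mono-≤ (pourTime-mono reverse≤) (pourTime₂-mono w≤)))))))
        (emit-runs O h then showRow-runs p then pop-runs then emit-runs O (digits ♯)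
         then pour-runs I T O (stacks [] [] (reverse p) [] k u v w) (λ _ → short) (λ _ → short) (bits-areBits s) refl
                (List.concatMap-pure (bits s)) (concatMap-zeros s)
         then restore
         then showTarget-runs w))
    where
    Z = concatMap digits (toList (literals (Vec.replicate n false)))
    o₁ = Z ʳ++ digits ♯ ʳ++ concatMap digits p ʳ++ h ʳ++ o

    bits≤ : length (bits s) ≤ M
    bits≤ = ℕ.≤-trans (ℕ.≤-reflexive (length-bits s)) n≤

    reverse≤ : length (reverse (bits s)) ≤ M
    reverse≤ = ℕ.≤-trans (ℕ.≤-reflexive (List.length-reverse (bits s))) bits≤

    restore : pour is-just T I [_] V none ⊢ stacks (♯ ∷ r) o₁ (reverse p) (reverse (bits s)) k u v w ⇒
      stacks (bits s ++ ♯ ∷ r) o₁ (reverse p) [] k u v w within pourTime (length (reverse (bits s)))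
    restore = subst (λ i → pour is-just T I [_] V none ⊢ stacks (♯ ∷ r) o₁ (reverse p) (reverse (bits s)) k u v w ⇒
        stacks i o₁ (reverse p) [] k u v w within pourTime (length (reverse (bits s))))
      (trans (List.ʳ++-ʳ++ (bits s) {[]} {♯ ∷ r}) refl)
      (drain-runs T I V (stacks (♯ ∷ r) o₁ (reverse p) [] k u v w) (λ _ → short) (λ _ → short) (reverse (bits s))
        (List.concatMap-pure (reverse (bits s))) (concatMap-none (reverse (bits s))))

    word≡ : w ʳ++ o₁ ≡ rowWord h w (p ++ ♯ ∷ toList (literals (Vec.replicate n false))) ʳ++ o
    word≡ = sym (trans (List.++-ʳ++ h) (trans
      (cong (_ʳ++ h ʳ++ o) (trans
        (cong (_++ w) (List.concatMap-++ digits p (♯ ∷ toList (literals (Vec.replicate n false)))))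
        (List.++-assoc (concatMap digits p) (digits ♯ ++ Z) w)))
      (trans (List.++-ʳ++ (concatMap digits p))
        (trans (cong (_ʳ++ concatMap digits p ʳ++ h ʳ++ o) (List.++-assoc (digits ♯) Z w))
          (sym (ʳ++-++₃ (digits ♯) Z w (concatMap digits p ʳ++ h ʳ++ o)))))))

  stepTime : ℕ → ℕ
  stepTime M = suc (writeSingletonTime M) + 1

  length-∷ʳ : ∀ (p : List Symbol) a n → length (p ++ a ∷ []) + n ≡ length p + suc n
  length-∷ʳ p a n = trans (cong (_+ n) (List.length-++ p)) (ℕ.+-assoc (length p) 1 n)

  -- Induction on the unread bits. Each step moves one position from `s` to `p`, so `length p + n`
  -- is invariant and one bound `M` serves all pours.
  writeSingletons-runs : ∀ {M n r o k u v} h w p (s : Subset n) → length h ≤ 6 → length w ≤ M →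
    length p + n ≤ M →
    writeSingletons h ⊢ stacks (bits s ++ ♯ ∷ r) o (reverse p) [] k u v w ⇒
      stacks (♯ ∷ r) (literalWords h w p (singletons s) ʳ++ o) (reverse (p ++ zeros n)) [] k u v w
      within loopTime (stepTime M) n
  writeSingletons-runs {M} {n} {r} {o} {k} {u} {v} h w p [] h≤ w≤ p≤ =
    subst (λ p′ → writeSingletons h ⊢ stacks (♯ ∷ r) o (reverse p) [] k u v w ⇒
                    stacks (♯ ∷ r) o (reverse p′) [] k u v w within 1)
      (sym (List.++-identityʳ p)) (loop-stop refl)
  writeSingletons-runs {M} {suc n} {r} {o} {k} {u} {v} h w p (b ∷ s) h≤ w≤ p≤ = finish b
    where
    p≤′ : length (p ++ 𝟎 ∷ []) + n ≤ M
    p≤′ = ℕ.≤-trans (ℕ.≤-reflexive (length-∷ʳ p 𝟎 n)) p≤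

    step : ∀ b {o o′} →
      if is 𝟏 on I then writeSingleton h else pop I ⊢ stacks (bit b ∷ bits s ++ ♯ ∷ r) o (reverse p) [] k u v w ⇒
        stacks (bits s ++ ♯ ∷ r) o′ (reverse p) [] k u v w within suc (writeSingletonTime M) →
      writeSingletons h ⊢ stacks (bit b ∷ bits s ++ ♯ ∷ r) o (reverse p) [] k u v w ⇒
        stacks (♯ ∷ r) (literalWords h w (p ++ 𝟎 ∷ []) (singletons s) ʳ++ o′) (reverse (p ++ zeros (suc n))) [] k u v w
        within loopTime (stepTime M) (suc n)
    step b {o} {o′} body = subst
      (λ p′ → writeSingletons h ⊢ stacks (bit b ∷ bits s ++ ♯ ∷ r) o (reverse p) [] k u v w ⇒
        stacks (♯ ∷ r) (literalWords h w (p ++ 𝟎 ∷ []) (singletons s) ʳ++ o′) (reverse p′) [] k u v w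
        within loopTime (stepTime M) (suc n))
      (List.++-assoc p (𝟎 ∷ []) (zeros n))
      (loop-step (isBit-bit b) (body then push-runs)
        (subst (λ a → writeSingletons h ⊢ stacks (bits s ++ ♯ ∷ r) o′ a [] k u v w ⇒
            stacks (♯ ∷ r) (literalWords h w (p ++ 𝟎 ∷ []) (singletons s) ʳ++ o′)
              (reverse ((p ++ 𝟎 ∷ []) ++ zeros n)) [] k u v w within loopTime (stepTime M) n)
          (reverse-∷ʳ p 𝟎) (writeSingletons-runs h w (p ++ 𝟎 ∷ []) s h≤ w≤ p≤′)))
      where
      isBit-bit : ∀ b → isBit (just (bit b)) ≡ true
      isBit-bit true  = refl
      isBit-bit false = refl

    finish : ∀ b → writeSingletons h ⊢ stacks (bit b ∷ bits s ++ ♯ ∷ r) o (reverse p) [] k u v w ⇒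
      stacks (♯ ∷ r) (literalWords h w p (singletons (b ∷ s)) ʳ++ o) (reverse (p ++ zeros (suc n))) [] k u v w
      within loopTime (stepTime M) (suc n)
    finish true = subst (λ o′ → writeSingletons h ⊢ stacks (𝟏 ∷ bits s ++ ♯ ∷ r) o (reverse p) [] k u v w ⇒
        stacks (♯ ∷ r) o′ (reverse (p ++ zeros (suc n))) [] k u v w within loopTime (stepTime M) (suc n))
      (trans (sym (List.++-ʳ++ (rowWord h w (p ++ ♯ ∷ toList (literals (Vec.replicate n false))))))
        (cong (λ l → (rowWord h w (p ++ ♯ ∷ toList (literals (Vec.replicate n false))) ++ l) ʳ++ o)
          (sym (literalWords-false∷ h w p (singletons s)))))
      (step true (then-branch refl (writeSingleton-runs h w p s h≤ w≤
        (ℕ.≤-trans (ℕ.m≤m+n (length p) (suc n)) p≤)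
        (ℕ.≤-trans (ℕ.n≤1+n n) (ℕ.≤-trans (ℕ.m≤n+m (suc n) (length p)) p≤)))))
    finish false = subst (λ o′ → writeSingletons h ⊢ stacks (𝟎 ∷ bits s ++ ♯ ∷ r) o (reverse p) [] k u v w ⇒
        stacks (♯ ∷ r) o′ (reverse (p ++ zeros (suc n))) [] k u v w within loopTime (stepTime M) (suc n))
      (cong (_ʳ++ o) (sym (literalWords-false∷ h w p (singletons s))))
      (step false (else-branch refl (weaken (s≤s z≤n) pop-runs)))

  -- Gates

  codes : ∀ {k} → Subset k → List Symbol
  codes s = toList (literals s)

  code : Symbol → List Symbol
  code 𝟏 = ♯ ∷ []
  code a = a ∷ []

  code-bits : ∀ {k} (s : Subset k) → concatMap code (bits s) ≡ codes s
  code-bits []          = refl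
  code-bits (true  ∷ s) = cong (♯ ∷_) (code-bits s)
  code-bits (false ∷ s) = cong (𝟎 ∷_) (code-bits s)

  code≤ : ∀ a → length (code a) ≤ 10
  code≤ 𝟎 = short
  code≤ 𝟏 = short
  code≤ ♯ = short

  codes-areCodes : ∀ {k} (s : Subset k) → All (λ a → isCode (just a) ≡ true) (codes s)
  codes-areCodes []          = []
  codes-areCodes (true  ∷ s) = refl ∷ codes-areCodes s
  codes-areCodes (false ∷ s) = refl ∷ codes-areCodes s

  length-codes : ∀ {k} (s : Subset k) → length (codes s) ≡ k
  length-codes s = Vec.length-toList (literals s)

  unitHead zeroHead : List Symbol
  unitHead = 𝟏 ∷ encodeℚ 1ℚ
  zeroHead = 𝟏 ∷ encodeℚ 0ℚ

  -- The coefficient 𝟏 of the gate's own wire doubles as a stop marker on `A`: clause coefficients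
  -- are only 𝟎 and ♯, so `clearCodes` halts there. The marker then becomes the 𝟎 that this wire has
  -- in all rows of earlier gates.
  clearCodes writeClause gateStep writeGates : Machine
  clearCodes  = pour isCode A T none V none
  writeClause = pour isBit I A code V none ⨾ writeRow unitHead
  gateStep = pop I ⨾ push A 𝟏
    ⨾ (if is 𝟏 on I then (pop I ⨾ writeSingletons unitHead) else (pop I ⨾ writeClause))
    ⨾ pop I ⨾ clearCodes ⨾ pop A ⨾ push A 𝟎
  writeGates = while is 𝟏 on I loop gateStep

  reverse-++ʳ : ∀ (p q : List Symbol) → reverse (p ++ q) ≡ q ʳ++ reverse p
  reverse-++ʳ p q = List.++-ʳ++ p

  all-ʳ++ : ∀ {P : Symbol → Set} {xs ys} → All P xs → All P ys → All P (xs ʳ++ ys)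
  all-ʳ++ []       qs = qs
  all-ʳ++ (p ∷ ps) qs = all-ʳ++ ps (p ∷ qs)

  clearCodes-runs : ∀ {i o k u v w} a xs → All (λ a → isCode (just a) ≡ true) xs →
    isCode (List.head a) ≡ false →
    clearCodes ⊢ stacks i o (xs ʳ++ a) [] k u v w ⇒ stacks i o a [] k u v w within pourTime (length xs)
  clearCodes-runs {i} {o} {k} {u} {v} {w} a xs cs stop = subst₂
    (λ l n → clearCodes ⊢ stacks i o l [] k u v w ⇒ stacks i o a [] k u v w within pourTime n)
    (sym (List.ʳ++-defn xs)) (List.length-reverse xs)
    (pour-runs A T V (stacks i o [] [] k u v w) (λ _ → short) (λ _ → short)
      (all-ʳ++ cs []) stop (concatMap-none (reverse xs)) (concatMap-none (reverse xs)))

  rowWords : ∀ {k} → List Symbol → List Symbol → List Symbol → List (Vec Symbol k) → List Symbol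
  rowWords h w p rs = concatMap (λ r → rowWord h w (p ++ toList r)) rs

  rowWords-∷ : ∀ {k} h w p a (rs : List (Vec Symbol k)) →
    rowWords h w p (List.map (a ∷_) rs) ≡ rowWords h w (p ++ a ∷ []) rs
  rowWords-∷ h w p a rs = trans (List.concatMap-map _ (a ∷_) rs)
    (List.concatMap-cong (λ r → cong (rowWord h w) (sym (List.++-assoc p (a ∷ []) (toList r)))) rs)

  rowWords-literals : ∀ {k} h w p (cs : List (Subset k)) →
    rowWords h w p (List.map literals cs) ≡ literalWords h w p cs
  rowWords-literals h w p cs = List.concatMap-map _ literals cs

  rowWords-clauses : ∀ {k} h w p (cs : List (Subset k)) →
    rowWords h w p (List.map (λ c → 𝟏 ∷ literals c) cs) ≡ literalWords h w (p ++ 𝟏 ∷ []) cs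
  rowWords-clauses h w p cs = trans (cong (rowWords h w p) (List.map-∘ cs))
    (trans (rowWords-∷ h w p 𝟏 (List.map literals cs)) (rowWords-literals h w (p ++ 𝟏 ∷ []) cs))

  clauseTime : ℕ → ℕ
  clauseTime M = pourTime M + rowTime M

  writeClause-runs : ∀ {M n r o k u v} w p (s : Subset n) → length w ≤ M → length p + n ≤ M →
    writeClause ⊢ stacks (bits s ++ ♯ ∷ r) o (reverse p) [] k u v w ⇒
      stacks (♯ ∷ r) (rowWord unitHead w (p ++ codes s) ʳ++ o) (reverse (p ++ codes s)) [] k u v w
      within clauseTime M
  writeClause-runs {M} {n} {r} {o} {k} {u} {v} w p s w≤ p≤ =
    weaken (pourTime-mono bits≤) load
    then writeRow-runs unitHead w (p ++ codes s) short w≤ codes≤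
    where
    bits≤ : length (bits s) ≤ M
    bits≤ = ℕ.≤-trans (ℕ.≤-reflexive (length-bits s)) (ℕ.≤-trans (ℕ.m≤n+m n (length p)) p≤)

    codes≤ : length (p ++ codes s) ≤ M
    codes≤ = ℕ.≤-trans (ℕ.≤-reflexive (trans (List.length-++ p) (cong (length p +_) (length-codes s)))) p≤

    load : pour isBit I A code V none ⊢ stacks (bits s ++ ♯ ∷ r) o (reverse p) [] k u v w ⇒
      stacks (♯ ∷ r) o (reverse (p ++ codes s)) [] k u v w within pourTime (length (bits s))
    load = subst (λ a → pour isBit I A code V none ⊢ stacks (bits s ++ ♯ ∷ r) o (reverse p) [] k u v w ⇒
        stacks (♯ ∷ r) o a [] k u v w within pourTime (length (bits s)))
      (sym (reverse-++ʳ p (codes s)))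
      (pour-runs I A V (stacks [] o [] [] k u v w) code≤ (λ _ → short) (bits-areBits s) refl
        (code-bits s) (concatMap-none (bits s)))

  branchTime gateTime : ℕ → ℕ
  branchTime M = 2 + (loopTime (stepTime M) M + clauseTime M)
  gateTime M = 1 + (1 + (branchTime M + (1 + (pourTime M + 2))))

  -- The zero columns of the gate wires, which precede the input columns.
  pad : ∀ {n k} → Gates n k → List Symbol
  pad inputs  = []
  pad (G ▹ _) = 𝟎 ∷ pad G

  gateWords : ∀ {k} → List Symbol → List Symbol → Gate k → List Symbol
  gateWords w p g = literalWords unitHead w p (clauses g)

  gateStep-runs : ∀ {M n o k u v i} w p (g : Gate n) → length w ≤ M → length p + suc n ≤ M →
    gateStep ⊢ stacks (𝟏 ∷ encodeType (type g) ∷ encodeSubset (fanIn g) ++ i) o (reverse p) [] k u v w ⇒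
      stacks i (gateWords w (p ++ 𝟏 ∷ []) g ʳ++ o) (reverse (p ++ 𝟎 ∷ [])) [] k u v w within gateTime M
  gateStep-runs {M} {n} {o} {k} {u} {v} {i} w p g w≤ p≤ =
    subst₂ (λ i′ a → gateStep ⊢ stacks (𝟏 ∷ encodeType (type g) ∷ i′) o (reverse p) [] k u v w ⇒
        stacks i (gateWords w p₁ g ʳ++ o) a [] k u v w within gateTime M)
      (sym (List.++-assoc (bits (fanIn g)) (♯ ∷ []) i)) (sym (reverse-∷ʳ p 𝟎))
      (pop-runs then push-runs then
        subst (λ a → rest ⊢ stacks (encodeType (type g) ∷ bits (fanIn g) ++ ♯ ∷ i) o a [] k u v w ⇒
          stacks i (gateWords w p₁ g ʳ++ o) (𝟎 ∷ reverse p) [] k u v w within _)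
        (reverse-∷ʳ p 𝟏) (branch g))
    where
    p₁ = p ++ 𝟏 ∷ []

    p₁≤ : length p₁ + n ≤ M
    p₁≤ = ℕ.≤-trans (ℕ.≤-reflexive (length-∷ʳ p 𝟏 n)) p≤

    n≤ : n ≤ M
    n≤ = ℕ.≤-trans (ℕ.m≤n+m n (length p₁)) p₁≤

    rest = (if is 𝟏 on I then (pop I ⨾ writeSingletons unitHead) else (pop I ⨾ writeClause))
      ⨾ pop I ⨾ clearCodes ⨾ pop A ⨾ push A 𝟎

    clear : ∀ {i o} xs → All (λ a → isCode (just a) ≡ true) xs → length xs ≤ M →
      pop I ⨾ clearCodes ⨾ pop A ⨾ push A 𝟎 ⊢ stacks (♯ ∷ i) o (reverse (p₁ ++ xs)) [] k u v w ⇒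
        stacks i o (𝟎 ∷ reverse p) [] k u v w within 1 + (pourTime M + 2)
    clear {i} {o} xs cs xs≤ = pop-runs then weaken (pourTime-mono xs≤)
      (subst (λ a → clearCodes ⊢ stacks i o a [] k u v w ⇒ stacks i o (𝟏 ∷ reverse p) [] k u v w
          within pourTime (length xs))
        (sym (trans (reverse-++ʳ p₁ xs) (cong (xs ʳ++_) (reverse-∷ʳ p 𝟏))))
        (clearCodes-runs (𝟏 ∷ reverse p) xs cs refl))
      then pop-runs then push-runs

    zeros-areCodes : ∀ m → All (λ a → isCode (just a) ≡ true) (zeros m)
    zeros-areCodes zero    = []
    zeros-areCodes (suc m) = refl ∷ zeros-areCodes m

    branch : ∀ g → rest ⊢ stacks (encodeType (type g) ∷ bits (fanIn g) ++ ♯ ∷ i) o (reverse p₁) [] k u v w ⇒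
      stacks i (gateWords w p₁ g ʳ++ o) (𝟎 ∷ reverse p) [] k u v w
      within branchTime M + (1 + (pourTime M + 2))
    branch (gate AND s _) =
      weaken (s≤s (s≤s (ℕ.≤-trans (loopTime-mono (ℕ.≤-refl {stepTime M}) n≤) (ℕ.m≤m+n _ _))))
        (then-branch refl (pop-runs then writeSingletons-runs unitHead w p₁ s short w≤ p₁≤))
      then clear (zeros n) (zeros-areCodes n) (ℕ.≤-trans (ℕ.≤-reflexive (List.length-replicate n)) n≤)
    branch (gate OR s _) =
      subst (λ l → if is 𝟏 on I then (pop I ⨾ writeSingletons unitHead) else (pop I ⨾ writeClause) ⊢
          stacks (𝟎 ∷ bits s ++ ♯ ∷ i) o (reverse p₁) [] k u v w ⇒
          stacks (♯ ∷ i) (l ʳ++ o) (reverse (p₁ ++ codes s)) [] k u v w within branchTime M)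
        (sym (List.++-identityʳ (rowWord unitHead w (p₁ ++ codes s))))
        (weaken (s≤s (s≤s (ℕ.m≤n+m (clauseTime M) (loopTime (stepTime M) M))))
          (else-branch refl (pop-runs then writeClause-runs w p₁ s w≤ p₁≤)))
      then clear (codes s) (codes-areCodes s) (ℕ.≤-trans (ℕ.≤-reflexive (length-codes s)) n≤)

  -- Each gate read extends the prefix by one zero, exactly as `gateRows` puts 𝟎 in front of the
  -- rows of earlier gates. The loop stops at the tag 𝟎 of `inputs`.
  writeGates-runs : ∀ {M n m o k u v} w p (G : Gates n m) → length w ≤ M → length p + m ≤ M →
    writeGates ⊢ stacks (encodeGates G) o (reverse p) [] k u v w ⇒
      stacks (𝟎 ∷ encodeUnary n) (rowWords unitHead w p (gateRows G) ʳ++ o) (reverse (p ++ pad G)) [] k u v w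
      within loopTime (gateTime M) m
  writeGates-runs {M} {n} {m} {o} {k} {u} {v} w p inputs w≤ p≤ =
    weaken (loopTime-mono (z≤n {gateTime M}) (z≤n {m}))
    (subst (λ p′ → writeGates ⊢ stacks (𝟎 ∷ encodeUnary n) o (reverse p) [] k u v w ⇒
        stacks (𝟎 ∷ encodeUnary n) o (reverse p′) [] k u v w within 1)
      (sym (List.++-identityʳ p)) (loop-stop refl))
  writeGates-runs {M} {n} {suc m} {o} {k} {u} {v} w p (G ▹ g) w≤ p≤ =
    subst₂ (λ o′ p′ → writeGates ⊢ stacks (encodeGates (G ▹ g)) o (reverse p) [] k u v w ⇒
        stacks (𝟎 ∷ encodeUnary n) o′ (reverse p′) [] k u v w within loopTime (gateTime M) (suc m))
      output≡ (List.++-assoc p (𝟎 ∷ []) (pad G))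
      (loop-step refl (gateStep-runs w p g w≤ p≤)
        (writeGates-runs w (p ++ 𝟎 ∷ []) G w≤
          (ℕ.≤-trans (ℕ.≤-reflexive (length-∷ʳ p 𝟎 m)) p≤)))
    where
    output≡ : rowWords unitHead w (p ++ 𝟎 ∷ []) (gateRows G) ʳ++ gateWords w (p ++ 𝟏 ∷ []) g ʳ++ o
            ≡ rowWords unitHead w p (gateRows (G ▹ g)) ʳ++ o
    output≡ = trans (sym (List.++-ʳ++ (gateWords w (p ++ 𝟏 ∷ []) g))) (cong (_ʳ++ o)
      (trans (cong₂ _++_ (sym (rowWords-clauses unitHead w p (clauses g)))
                         (sym (rowWords-∷ unitHead w p 𝟎 (gateRows G))))
        (sym (List.concatMap-++ (λ r → rowWord unitHead w (p ++ toList r))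
          (List.map (λ c → 𝟏 ∷ literals c) (clauses g)) (List.map (𝟎 ∷_) (gateRows G))))))

  -- Computing the reciprocal target

  ones : ℕ → List Symbol
  ones n = replicate n 𝟏

  ones-ʳ++ : ∀ m n → ones m ʳ++ ones n ≡ ones (m + n)
  ones-ʳ++ zero    n = refl
  ones-ʳ++ (suc m) n = trans (ones-ʳ++ m (suc n)) (cong ones (ℕ.+-suc m n))

  reverse-ones : ∀ n → reverse (ones n) ≡ ones n
  reverse-ones n = trans (ones-ʳ++ n 0) (cong ones (ℕ.+-identityʳ n))

  ten : Symbol → List Symbol
  ten _ = ones 10

  concatMap-ten : ∀ n → concatMap ten (ones n) ≡ ones (n * 10)
  concatMap-ten zero    = refl
  concatMap-ten (suc n) = cong (ones 10 ++_) (concatMap-ten n)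

  -- Unary multiplication: each symbol consumed from `U` adds ten copies of `K` to `V`.
  multiplyLoop multiply : Machine
  multiplyLoop = while is-just on U loop
    (pop U ⨾ pour is-just K T [_] V ten ⨾ pour is-just T K [_] V none)
  multiply = multiplyLoop ⨾ pour is-just V U [_] T none

  power : ℕ → Machine
  power zero    = skip
  power (suc j) = multiply ⨾ power j

  multiplyLoop-runs : ∀ {M i o a y} κ m v → κ ≤ M →
    multiplyLoop ⊢ stacks i o a [] (ones κ) (ones m) (ones v) y ⇒
      stacks i o a [] (ones κ) [] (ones (m * (κ * 10) + v)) y within loopTime (1 + pourTime₂ M) m
  multiplyLoop-runs κ zero    v κ≤ = loop-stop refl
  multiplyLoop-runs {M} {i} {o} {a} {y} κ (suc m) v κ≤ = loop-step refl
    (weaken (s≤s (pourTime₂-mono κ≤)) (pop-runs then add then back))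
    (subst (λ n → multiplyLoop ⊢ stacks i o a [] (ones κ) (ones m) (ones (κ * 10 + v)) y ⇒
        stacks i o a [] (ones κ) [] (ones n) y within loopTime (1 + pourTime₂ M) m)
      (trans (sym (ℕ.+-assoc (m * (κ * 10)) (κ * 10) v)) (cong (_+ v) (ℕ.+-comm (m * (κ * 10)) (κ * 10))))
      (multiplyLoop-runs κ m (κ * 10 + v) κ≤))
    where
    add : pour is-just K T [_] V ten ⊢ stacks i o a [] (ones κ) (ones m) (ones v) y ⇒
      stacks i o a (ones κ) [] (ones m) (ones (κ * 10 + v)) y within pourTime κ
    add = subst (λ n → pour is-just K T [_] V ten ⊢ stacks i o a [] (ones κ) (ones m) (ones v) y ⇒
        stacks i o a (ones κ) [] (ones m) (ones (κ * 10 + v)) y within pourTime n) (List.length-replicate κ)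
      (subst₂ (λ t v′ → pour is-just K T [_] V ten ⊢ stacks i o a [] (ones κ) (ones m) (ones v) y ⇒
          stacks i o a t [] (ones m) v′ y within pourTime (length (ones κ)))
        (reverse-ones κ) (ones-ʳ++ (κ * 10) v)
        (drain-runs K T V (stacks i o a [] [] (ones m) [] y) (λ _ → short) (λ _ → short) (ones κ)
          (List.concatMap-pure (ones κ)) (concatMap-ten κ)))

    back : pour is-just T K [_] V none ⊢ stacks i o a (ones κ) [] (ones m) (ones (κ * 10 + v)) y ⇒
      stacks i o a [] (ones κ) (ones m) (ones (κ * 10 + v)) y within pourTime κ
    back = subst₂ (λ n k → pour is-just T K [_] V none ⊢ stacks i o a (ones κ) [] (ones m) (ones (κ * 10 + v)) y ⇒
        stacks i o a [] k (ones m) (ones (κ * 10 + v)) y within pourTime n) (List.length-replicate κ) (reverse-ones κ)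
      (drain-runs T K V (stacks i o a [] [] (ones m) [] y) (λ _ → short) (λ _ → short) (ones κ)
        (List.concatMap-pure (ones κ)) (concatMap-none (ones κ)))

  multiplyTime : ℕ → ℕ
  multiplyTime M = loopTime (1 + pourTime₂ M) M + pourTime M

  multiply-runs : ∀ {M i o a y} κ m → κ ≤ M → m ≤ M → m * (κ * 10) ≤ M →
    multiply ⊢ stacks i o a [] (ones κ) (ones m) [] y ⇒
      stacks i o a [] (ones κ) (ones (m * (κ * 10))) [] y within multiplyTime M
  multiply-runs {M} {i} {o} {a} {y} κ m κ≤ m≤ mκ≤ =
    weaken (loopTime-mono (ℕ.≤-refl {1 + pourTime₂ M}) m≤)
      (subst (λ n → multiplyLoop ⊢ stacks i o a [] (ones κ) (ones m) [] y ⇒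
          stacks i o a [] (ones κ) [] (ones n) y within loopTime (1 + pourTime₂ M) m)
        (ℕ.+-identityʳ (m * (κ * 10))) (multiplyLoop-runs κ m 0 κ≤))
    then weaken (pourTime-mono (ℕ.≤-trans (ℕ.≤-reflexive (List.length-replicate (m * (κ * 10)))) mκ≤))
      (subst (λ u → pour is-just V U [_] T none ⊢ stacks i o a [] (ones κ) [] (ones (m * (κ * 10))) y ⇒
          stacks i o a [] (ones κ) u [] y within pourTime (length (ones (m * (κ * 10)))))
        (reverse-ones (m * (κ * 10)))
        (drain-runs V U T (stacks i o a [] (ones κ) [] [] y) (λ _ → short) (λ _ → short) (ones (m * (κ * 10)))
          (List.concatMap-pure (ones (m * (κ * 10)))) (concatMap-none (ones (m * (κ * 10))))))

  powerTime : ℕ → ℕ → ℕ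
  powerTime zero    M = 1
  powerTime (suc j) M = multiplyTime M + powerTime j M

  -- As `κ` is nonzero, no intermediate product exceeds the final one, so the bound on the latter
  -- controls every multiplication.
  power-runs : ∀ {M i o a y} κ .{{_ : ℕ.NonZero κ}} j m → κ ≤ M → m * (κ * 10) ^ j ≤ M →
    power j ⊢ stacks i o a [] (ones κ) (ones m) [] y ⇒
      stacks i o a [] (ones κ) (ones (m * (κ * 10) ^ j)) [] y within powerTime j M
  power-runs {M} {i} {o} {a} {y} κ zero m κ≤ m≤ =
    subst (λ n → skip ⊢ stacks i o a [] (ones κ) (ones m) [] y ⇒
        stacks i o a [] (ones κ) (ones n) [] y within 1)
      (sym (ℕ.*-identityʳ m)) (1 , skip , ℕ.≤-refl)
  power-runs {M} {i} {o} {a} {y} κ (suc j) m κ≤ m≤ =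
    multiply-runs κ m κ≤ (ℕ.≤-trans (ℕ.m≤m*n m (κ * 10)) mκ≤) mκ≤
    then subst (λ n → power j ⊢ stacks i o a [] (ones κ) (ones (m * (κ * 10))) [] y ⇒
        stacks i o a [] (ones κ) (ones n) [] y within powerTime j M)
      (ℕ.*-assoc m (κ * 10) ((κ * 10) ^ j)) (power-runs κ j (m * (κ * 10)) κ≤ m≤′)
    where
    instance
      κ10≢0 : ℕ.NonZero (κ * 10)
      κ10≢0 = ℕ.m*n≢0 κ 10

    m≤′ : m * (κ * 10) * (κ * 10) ^ j ≤ M
    m≤′ = ℕ.≤-trans (ℕ.≤-reflexive (ℕ.*-assoc m (κ * 10) ((κ * 10) ^ j))) m≤

    mκ≤ : m * (κ * 10) ≤ M
    mκ≤ = ℕ.≤-trans (ℕ.m≤m*n (m * (κ * 10)) ((κ * 10) ^ j) {{ℕ.m^n≢0 (κ * 10) j}}) m≤′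

  -- Counting in bijective binary

  bump increment count : Machine
  bump = if is 𝟏 on Y then (pop Y ⨾ push Y 𝟎) else push Y 𝟏
  increment = pour (is 𝟎) Y T one V none ⨾ bump ⨾ pour is-just T Y [_] V none
  count = while is-just on U loop (pop U ⨾ increment)

  -- Incrementing turns leading digits 2 (𝟎) into 1 (𝟏) and carries past them.
  data Carry : List Symbol → List Symbol → Set where
    carry : ∀ j r r′ →
      (∀ {i o a t k u v} → bump ⊢ stacks i o a t k u v r ⇒ stacks i o a t k u v r′ within 3) →
      is 𝟎 (List.head r) ≡ false → Carry (zeros j ++ r) (ones j ++ r′)

  carry-suc : ∀ n → Carry (encodeℕᵇ n) (encodeℕᵇ (ℕᵇ.suc n))
  carry-suc ℕᵇ.zero  = carry 0 _ _ (weaken (s≤s (s≤s z≤n)) (else-branch refl push-runs)) refl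
  carry-suc 1+[2 n ] = carry 0 _ _ (then-branch refl (pop-runs then push-runs)) refl
  carry-suc 2[1+ n ] with encodeℕᵇ n | encodeℕᵇ (ℕᵇ.suc n) | carry-suc n
  ... | _ | _ | carry j r r′ b e = carry (suc j) r r′ b e

  incrementTime : ℕ → ℕ
  incrementTime M = pourTime M + (3 + pourTime M)

  concatMap-one : ∀ xs → concatMap one xs ≡ ones (length xs)
  concatMap-one []       = refl
  concatMap-one (_ ∷ xs) = cong (𝟏 ∷_) (concatMap-one xs)

  increment-runs : ∀ {M i o a k u v y y′} → Carry y y′ → length y ≤ M →
    increment ⊢ stacks i o a [] k u v y ⇒ stacks i o a [] k u v y′ within incrementTime M
  increment-runs {M} {i} {o} {a} {k} {u} {v} (carry j r r′ b e) y≤ =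
    weaken (pourTime-mono zeros≤)
      (subst (λ t → pour (is 𝟎) Y T one V none ⊢ stacks i o a [] k u v (zeros j ++ r) ⇒
          stacks i o a t k u v r within pourTime (length (zeros j)))
        (reverse-ones j)
        (pour-runs Y T V (stacks i o a [] k u v []) (λ _ → short) (λ _ → short) (all-zeros j) e
          (trans (concatMap-one (zeros j)) (cong ones (List.length-replicate j))) (concatMap-none (zeros j))))
    then b then
    weaken (pourTime-mono ones≤)
      (subst (λ y → pour is-just T Y [_] V none ⊢ stacks i o a (ones j) k u v r′ ⇒
          stacks i o a [] k u v y within pourTime (length (ones j)))
        (trans (cong (_ʳ++ r′) (sym (reverse-ones j))) (List.ʳ++-ʳ++ (ones j)))
        (drain-runs T Y V (stacks i o a [] k u v r′) (λ _ → short) (λ _ → short) (ones j)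
          (List.concatMap-pure (ones j)) (concatMap-none (ones j))))
    where
    all-zeros : ∀ j → All (λ a → is 𝟎 (just a) ≡ true) (zeros j)
    all-zeros zero    = []
    all-zeros (suc j) = refl ∷ all-zeros j

    zeros≤ : length (zeros j) ≤ M
    zeros≤ = ℕ.≤-trans (ℕ.≤-trans (ℕ.m≤m+n _ (length r)) (ℕ.≤-reflexive (sym (List.length-++ (zeros j))))) y≤

    ones≤ : length (ones j) ≤ M
    ones≤ = ℕ.≤-trans (ℕ.≤-reflexive (trans (List.length-replicate j) (sym (List.length-replicate j)))) zeros≤

  length-encodeℕᵇ-suc : ∀ n → length (encodeℕᵇ (ℕᵇ.suc n)) ≤ suc (length (encodeℕᵇ n))
  length-encodeℕᵇ-suc ℕᵇ.zero  = ℕ.≤-refl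
  length-encodeℕᵇ-suc 2[1+ n ] = s≤s (length-encodeℕᵇ-suc n)
  length-encodeℕᵇ-suc 1+[2 n ] = ℕ.n≤1+n _

  -- Far from sharp, but the numbers counted are themselves polynomially bounded.
  length-encodeℕᵇ : ∀ n → length (encodeℕᵇ (ℕᵇ.fromℕ' n)) ≤ suc n
  length-encodeℕᵇ zero    = ℕ.≤-refl
  length-encodeℕᵇ (suc n) = ℕ.≤-trans (length-encodeℕᵇ-suc (ℕᵇ.fromℕ' n)) (s≤s (length-encodeℕᵇ n))

  -- `ℕᵇ.fromℕ'` is iterated successor, hence in step with one increment per symbol of `U`.
  count-runs : ∀ {M i o a k v} m n → suc (m + n) ≤ M →
    count ⊢ stacks i o a [] k (ones m) v (encodeℕᵇ (ℕᵇ.fromℕ' n)) ⇒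
      stacks i o a [] k [] v (encodeℕᵇ (ℕᵇ.fromℕ' (m + n))) within loopTime (1 + incrementTime M) m
  count-runs zero    n ≤M = loop-stop refl
  count-runs {M} {i} {o} {a} {k} {v} (suc m) n ≤M = loop-step refl
    (pop-runs then increment-runs (carry-suc (ℕᵇ.fromℕ' n))
      (ℕ.≤-trans (length-encodeℕᵇ n) (ℕ.≤-trans (s≤s (ℕ.m≤n+m n (suc m))) ≤M)))
    (subst (λ l → count ⊢ stacks i o a [] k (ones m) v (encodeℕᵇ (ℕᵇ.fromℕ' (suc n))) ⇒
        stacks i o a [] k [] v (encodeℕᵇ (ℕᵇ.fromℕ' l)) within loopTime (1 + incrementTime M) m)
      (ℕ.+-suc m n)
      (count-runs m (suc n) (ℕ.≤-trans (s≤s (ℕ.≤-reflexive (ℕ.+-suc m n))) ≤M)))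

  clearTarget : Machine
  clearTarget = pour is-just Y T none V none

  clearTarget-runs : ∀ {i o a t k u v} y →
    clearTarget ⊢ stacks i o a t k u v y ⇒ stacks i o a t k u v [] within pourTime (length y)
  clearTarget-runs {i} {o} {a} {t} {k} {u} {v} y =
    drain-runs Y T V (stacks i o a t k u v []) (λ _ → short) (λ _ → short) y (concatMap-none y) (concatMap-none y)

  -- `push U 𝟏` starts the product at 1 and `push Y ♯` the counter at 0. The last emission puts the
  -- sign and the numerator 1 in front of the counted denominator, in reverse because it pushes.
  targetProgram : ℕ → Machine
  targetProgram ℓ = clearTarget ⨾ push U 𝟏 ⨾ power (suc ℓ) ⨾ push Y ♯ ⨾ count ⨾ emit Y (♯ ∷ 𝟏 ∷ 𝟏 ∷ [])

  targetTime : ℕ → ℕ → ℕ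
  targetTime ℓ M = pourTime M + (1 + (powerTime (suc ℓ) M + (1 + (loopTime (1 + incrementTime M) M + 4))))

  encodeℚ-reciprocal : ∀ m .{{_ : ℕ.NonZero m}} →
    encodeℚ (reciprocal m) ≡ 𝟏 ∷ 𝟏 ∷ ♯ ∷ encodeℕᵇ (ℕᵇ.fromℕ' m)
  encodeℚ-reciprocal m = cong (λ n → 𝟏 ∷ 𝟏 ∷ ♯ ∷ encodeℕᵇ n)
    (trans (cong ℕᵇ.fromℕ (ℕ.suc-pred m)) (ℕᵇ.fromℕ≡fromℕ' m))

  targetProgram-runs : ∀ {M i o a y} ℓ κ .{{_ : ℕ.NonZero κ}} → κ ≤ M → length y ≤ M → suc ((10 * κ) ^ suc ℓ) ≤ M →
    targetProgram ℓ ⊢ stacks i o a [] (ones κ) [] [] y ⇒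
      stacks i o a [] (ones κ) [] [] (encodeℚ (reciprocal ((10 * κ) ^ suc ℓ))) within targetTime ℓ M
  targetProgram-runs {M} {i} {o} {a} {y} ℓ κ κ≤ y≤ N≤ =
    weaken (pourTime-mono y≤) (clearTarget-runs y) then push-runs then
    subst (λ n → power (suc ℓ) ⊢ stacks i o a [] (ones κ) (𝟏 ∷ []) [] [] ⇒
        stacks i o a [] (ones κ) (ones n) [] [] within powerTime (suc ℓ) M) N≡
      (power-runs κ (suc ℓ) 1 κ≤ (ℕ.≤-trans (ℕ.≤-reflexive N≡) (ℕ.≤-trans (ℕ.n≤1+n N) N≤)))
    then push-runs then
    weaken (loopTime-mono (ℕ.≤-refl {1 + incrementTime M}) (ℕ.≤-trans (ℕ.n≤1+n N) N≤))
      (count-runs N 0 (ℕ.≤-trans (s≤s (ℕ.≤-reflexive (ℕ.+-identityʳ N))) N≤))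
    then subst (λ y → emit Y (♯ ∷ 𝟏 ∷ 𝟏 ∷ []) ⊢ stacks i o a [] (ones κ) [] [] (encodeℕᵇ (ℕᵇ.fromℕ' (N + 0))) ⇒
        stacks i o a [] (ones κ) [] [] y within 4)
      (sym (trans (encodeℚ-reciprocal N {{N≢0}})
        (cong (λ n → 𝟏 ∷ 𝟏 ∷ ♯ ∷ encodeℕᵇ (ℕᵇ.fromℕ' n)) (sym (ℕ.+-identityʳ N)))))
      (emit-runs Y (♯ ∷ 𝟏 ∷ 𝟏 ∷ []))
    where
    N = (10 * κ) ^ suc ℓ

    N≢0 : ℕ.NonZero N
    N≢0 = ℕ.m^n≢0 (10 * κ) (suc ℓ) {{ℕ.m*n≢0 10 κ}}

    N≡ : 1 * (κ * 10) ^ suc ℓ ≡ N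
    N≡ = trans (ℕ.*-identityˡ _) (cong (_^ suc ℓ) (ℕ.*-comm κ 10))

  -- The reduction program

  -- The subset marking the output has one bit per wire, so a single pour both loads the output row
  -- and counts the wires on `K`. The `push O 𝟏` before copying `K` adds the dimension of the extra
  -- weight.
  headerProgram trailerProgram : Machine
  headerProgram = emit Y (reverse (encodeℚ 0ℚ)) ⨾ pour isBit I A code K one ⨾ pop I
    ⨾ push O 𝟏 ⨾ pour is-just K T [_] O [_] ⨾ pour is-just T K [_] V none ⨾ push O ♯
    ⨾ writeRow unitHead ⨾ clearCodes
  trailerProgram = writeSingletons zeroHead ⨾ pop I
    ⨾ clearTarget ⨾ emit Y (reverse (encodeℚ 2ℚ)) ⨾ writeRow unitHead
    ⨾ push O ♯

  headerTime : ℕ → ℕ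
  headerTime M = 5 + (pourTime M + (1 + (1 + (pourTime M + (pourTime M + (1 + (rowTime M + pourTime M)))))))

  headerProgram-runs : ∀ {M κ r} (s : Subset κ) → κ ≤ M → 4 ≤ M →
    headerProgram ⊢ stacks (bits s ++ ♯ ∷ r) [] [] [] [] [] [] [] ⇒
      stacks r (rowWord unitHead (encodeℚ 0ℚ) (codes s) ʳ++ encodeUnary (suc κ) ʳ++ []) [] [] (ones κ) [] [] (encodeℚ 0ℚ)
      within headerTime M
  headerProgram-runs {M} {κ} {r} s κ≤ 4≤ =
    emit-runs Y (reverse (encodeℚ 0ℚ))
    then weaken (pourTime-mono (ℕ.≤-trans (ℕ.≤-reflexive (length-bits s)) κ≤))
      (subst (λ k → pour isBit I A code K one ⊢ stacks (bits s ++ ♯ ∷ r) [] [] [] [] [] [] w₀ ⇒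
          stacks (♯ ∷ r) [] (reverse (codes s)) [] k [] [] w₀ within pourTime (length (bits s)))
        (reverse-ones κ)
        (pour-runs I A K (stacks [] [] [] [] [] [] [] w₀) code≤ (λ _ → short) (bits-areBits s) refl
          (code-bits s) (trans (concatMap-one (bits s)) (cong ones (length-bits s)))))
    then pop-runs then push-runs
    then weaken (pourTime-mono ones≤)
      (subst (λ t → pour is-just K T [_] O [_] ⊢ stacks r (𝟏 ∷ []) (reverse (codes s)) [] (ones κ) [] [] w₀ ⇒
          stacks r (ones κ ʳ++ 𝟏 ∷ []) (reverse (codes s)) t [] [] [] w₀ within pourTime (length (ones κ)))
        (reverse-ones κ)
        (drain-runs K T O (stacks r [] (reverse (codes s)) [] [] [] [] w₀) (λ _ → short) (λ _ → short) (ones κ)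
          (List.concatMap-pure (ones κ)) (List.concatMap-pure (ones κ))))
    then weaken (pourTime-mono ones≤)
      (subst (λ k → pour is-just T K [_] V none ⊢
          stacks r (ones κ ʳ++ 𝟏 ∷ []) (reverse (codes s)) (ones κ) [] [] [] w₀ ⇒
          stacks r (ones κ ʳ++ 𝟏 ∷ []) (reverse (codes s)) [] k [] [] w₀ within pourTime (length (ones κ)))
        (reverse-ones κ)
        (drain-runs T K V (stacks r (ones κ ʳ++ 𝟏 ∷ []) (reverse (codes s)) [] [] [] [] w₀)
          (λ _ → short) (λ _ → short) (ones κ) (List.concatMap-pure (ones κ)) (concatMap-none (ones κ))))
    then subst (λ o → push O ♯ ⊢ stacks r (ones κ ʳ++ 𝟏 ∷ []) (reverse (codes s)) [] (ones κ) [] [] w₀ ⇒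
          stacks r o (reverse (codes s)) [] (ones κ) [] [] w₀ within 1)
        (sym (List.++-ʳ++ (ones (suc κ)))) push-runs
    then writeRow-runs unitHead w₀ (codes s) short 4≤ (ℕ.≤-trans (ℕ.≤-reflexive (length-codes s)) κ≤)
    then weaken (pourTime-mono (ℕ.≤-trans (ℕ.≤-reflexive (length-codes s)) κ≤))
      (clearCodes-runs [] (codes s) (codes-areCodes s) refl)
    where
    w₀ = encodeℚ 0ℚ

    ones≤ : length (ones κ) ≤ M
    ones≤ = ℕ.≤-trans (ℕ.≤-reflexive (List.length-replicate κ)) κ≤

  bits-⊤ : ∀ n → bits (⊤ {n}) ≡ ones n
  bits-⊤ zero    = refl
  bits-⊤ (suc n) = cong (𝟏 ∷_) (bits-⊤ n)

  trailerTime : ℕ → ℕ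
  trailerTime M = loopTime (stepTime M) M + (1 + (pourTime M + (6 + (rowTime M + 1))))

  -- The unary input count reads as the bit string of the full subset, so the singleton writer
  -- yields the input samples. It leaves only zeros on `A`, which is the row of the unit sample.
  trailerProgram-runs : ∀ {M n o p k u v w} → length w ≤ M → length p + n ≤ M → 5 ≤ M →
    trailerProgram ⊢ stacks (encodeUnary n) o (reverse p) [] k u v w ⇒
      stacks [] (♯ ∷ rowWord unitHead (encodeℚ 2ℚ) (p ++ zeros n)
                   ʳ++ literalWords zeroHead w p (singletons (⊤ {n})) ʳ++ o)
        (reverse (p ++ zeros n)) [] k u v (encodeℚ 2ℚ)
      within trailerTime M
  trailerProgram-runs {M} {n} {o} {p} {k} {u} {v} {w} w≤ p≤ 5≤ =
    weaken (loopTime-mono (ℕ.≤-refl {stepTime M}) n≤)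
      (subst (λ i → writeSingletons zeroHead ⊢ stacks (i ++ ♯ ∷ []) o (reverse p) [] k u v w ⇒
          stacks (♯ ∷ []) (literalWords zeroHead w p (singletons (⊤ {n})) ʳ++ o) (reverse (p ++ zeros n)) [] k u v w
          within loopTime (stepTime M) n)
        (bits-⊤ n) (writeSingletons-runs zeroHead w p (⊤ {n}) short w≤ p≤))
    then pop-runs then weaken (pourTime-mono w≤) (clearTarget-runs w)
    then emit-runs Y (reverse (encodeℚ 2ℚ))
    then writeRow-runs unitHead (encodeℚ 2ℚ) (p ++ zeros n) short 5≤ zeros≤
    then push-runs
    where
    n≤ : n ≤ M
    n≤ = ℕ.≤-trans (ℕ.m≤n+m n (length p)) p≤

    zeros≤ : length (p ++ zeros n) ≤ M
    zeros≤ = ℕ.≤-trans (ℕ.≤-reflexive (trans (List.length-++ p) (cong (length p +_) (List.length-replicate n)))) p≤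

  -- A step pushes at most one symbol, so the running time bounds what is written.
  length-lookup-runs : ∀ {k} {P : Program k} {s t s′} → Runs P s t s′ →
    ∀ i → length (lookup s′ i) ≤ length (lookup s i) + t
  length-lookup-runs {s = s} skip i = ℕ.m≤m+n (length (lookup s i)) 1
  length-lookup-runs {s = s} (push {i = j} {a}) i with i Fin.≟ j
  ... | yes refl = ℕ.≤-reflexive (trans (cong length (Vec.lookup∘updateAt i s)) (ℕ.+-comm 1 (length (lookup s i))))
  ... | no  i≢j  = ℕ.≤-trans (ℕ.≤-reflexive (cong length (Vec.lookup∘updateAt′ i j i≢j s))) (ℕ.m≤m+n (length (lookup s i)) 1)
  length-lookup-runs {s = s} (pop {i = j}) i with i Fin.≟ j
  ... | yes refl = ℕ.≤-trans (ℕ.≤-reflexive (trans (cong length (Vec.lookup∘updateAt i s)) (List.length-drop 1 (lookup s i))))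
                     (ℕ.≤-trans (ℕ.m∸n≤m (length (lookup s i)) 1) (ℕ.m≤m+n (length (lookup s i)) 1))
  ... | no  i≢j  = ℕ.≤-trans (ℕ.≤-reflexive (cong length (Vec.lookup∘updateAt′ i j i≢j s))) (ℕ.m≤m+n (length (lookup s i)) 1)
  length-lookup-runs {s = s} (comp {t = t} {u} p q) i = ℕ.≤-trans (length-lookup-runs q i)
    (ℕ.≤-trans (ℕ.+-monoˡ-≤ u (length-lookup-runs p i)) (ℕ.≤-reflexive (ℕ.+-assoc (length (lookup s i)) t u)))
  length-lookup-runs {s = s} (if-true {t = t} _ p) i =
    ℕ.≤-trans (length-lookup-runs p i) (ℕ.+-monoʳ-≤ (length (lookup s i)) (ℕ.n≤1+n t))
  length-lookup-runs {s = s} (if-false {t = t} _ p) i =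
    ℕ.≤-trans (length-lookup-runs p i) (ℕ.+-monoʳ-≤ (length (lookup s i)) (ℕ.n≤1+n t))
  length-lookup-runs {s = s} (while-false _) i = ℕ.m≤m+n (length (lookup s i)) 1
  length-lookup-runs {s = s} (while-true {t = t} {u} _ p q) i = ℕ.≤-trans (length-lookup-runs q i)
    (ℕ.≤-trans (ℕ.+-monoˡ-≤ u (length-lookup-runs p i))
      (ℕ.≤-trans (ℕ.≤-reflexive (ℕ.+-assoc (length (lookup s i)) t u))
        (ℕ.+-monoʳ-≤ (length (lookup s i)) (ℕ.n≤1+n (t + u)))))

  -- The encoded samples as a concatenation of rows

  rowWords-inputRows : ∀ {n k} h w p (G : Gates n k) →
    rowWords h w p (inputRows G) ≡ literalWords h w (p ++ pad G) (singletons (⊤ {n}))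
  rowWords-inputRows {n} h w p inputs  = trans (rowWords-literals h w p (singletons (⊤ {n})))
    (cong (λ p → literalWords h w p (singletons (⊤ {n}))) (sym (List.++-identityʳ p)))
  rowWords-inputRows {n} h w p (G ▹ g) = trans (rowWords-∷ h w p 𝟎 (inputRows G))
    (trans (rowWords-inputRows h w (p ++ 𝟎 ∷ []) G)
      (cong (λ p → literalWords h w p (singletons (⊤ {n}))) (List.++-assoc p (𝟎 ∷ []) (pad G))))

  pad-zeros : ∀ {n k} (G : Gates n k) → pad G ++ zeros n ≡ zeros k
  pad-zeros inputs  = refl
  pad-zeros (G ▹ _) = cong (𝟎 ∷_) (pad-zeros G)

  length-pad : ∀ {n k} (G : Gates n k) → length (pad G) + n ≡ k
  length-pad inputs  = refl
  length-pad (G ▹ _) = cong suc (length-pad G)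

  encodePoints-sample : ∀ {k} s q (r : Vec Symbol k) ps →
    encodePoints (sample s q r ∷ ps) ≡ rowWord (𝟏 ∷ digits s) (encodeℚ q) (toList r) ++ encodePoints ps
  encodePoints-sample s q r ps = cong (𝟏 ∷_) (begin
    (digits s ++ concatMap encodeℚ (toList (Vec.map coefficient r))) ++ encodeℚ q ++ encodePoints ps
      ≡⟨ cong (λ l → (digits s ++ l) ++ encodeℚ q ++ encodePoints ps)
           (trans (cong (concatMap encodeℚ) (Vec.toList-map coefficient r))
             (List.concatMap-map encodeℚ coefficient (toList r))) ⟩
    (digits s ++ concatMap digits (toList r)) ++ encodeℚ q ++ encodePoints ps
      ≡⟨ List.++-assoc (digits s) (concatMap digits (toList r)) _ ⟩
    digits s ++ concatMap digits (toList r) ++ encodeℚ q ++ encodePoints ps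
      ≡⟨ cong (digits s ++_) (List.++-assoc (concatMap digits (toList r)) (encodeℚ q) (encodePoints ps)) ⟨
    digits s ++ (concatMap digits (toList r) ++ encodeℚ q) ++ encodePoints ps
      ≡⟨ List.++-assoc (digits s) (concatMap digits (toList r) ++ encodeℚ q) (encodePoints ps) ⟨
    (digits s ++ concatMap digits (toList r) ++ encodeℚ q) ++ encodePoints ps ∎)
    where open ≡-Reasoning

  encodePoints-samples : ∀ {k} s q (rs : List (Vec Symbol k)) ps →
    encodePoints (List.map (sample s q) rs ++ ps) ≡ rowWords (𝟏 ∷ digits s) (encodeℚ q) [] rs ++ encodePoints ps
  encodePoints-samples s q []       ps = refl
  encodePoints-samples s q (r ∷ rs) ps = trans (encodePoints-sample s q r _)
    (trans (cong (rowWord (𝟏 ∷ digits s) (encodeℚ q) (toList r) ++_) (encodePoints-samples s q rs ps))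
      (sym (List.++-assoc (rowWord (𝟏 ∷ digits s) (encodeℚ q) (toList r)) _ (encodePoints ps))))

  toList-replicate : ∀ k → toList (Vec.replicate k 𝟎) ≡ zeros k
  toList-replicate zero    = refl
  toList-replicate (suc k) = cong (𝟎 ∷_) (toList-replicate k)

  encodePoints-circuitSamples : ∀ {n k} (G : Gates n k) o q →
    encodePoints (circuitSamples G o q) ≡
      rowWord unitHead (encodeℚ 0ℚ) (codes ⁅ o ⁆)
      ++ rowWords unitHead (encodeℚ 0ℚ) [] (gateRows G)
      ++ literalWords zeroHead (encodeℚ q) (pad G) (singletons (⊤ {n}))
      ++ rowWord unitHead (encodeℚ 2ℚ) (pad G ++ zeros n) ++ ♯ ∷ []
  encodePoints-circuitSamples {n} {k} G o q =
    trans (encodePoints-sample 𝟏 0ℚ (literals ⁅ o ⁆) _)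
      (cong (rowWord unitHead (encodeℚ 0ℚ) (codes ⁅ o ⁆) ++_)
        (trans (encodePoints-samples 𝟏 0ℚ (gateRows G) _)
          (cong (rowWords unitHead (encodeℚ 0ℚ) [] (gateRows G) ++_)
            (trans (encodePoints-samples 𝟎 q (inputRows G) _)
              (cong₂ _++_ (rowWords-inputRows zeroHead (encodeℚ q) [] G)
                (trans (encodePoints-sample 𝟏 2ℚ (Vec.replicate k 𝟎) [])
                  (cong (λ p → rowWord unitHead (encodeℚ 2ℚ) p ++ ♯ ∷ [])
                    (trans (toList-replicate k) (sym (pad-zeros G))))))))))

  -- The complete program

  writeSamples reduceProgram : ℕ → Machine
  writeSamples ℓ = headerProgram ⨾ writeGates ⨾ pop I ⨾ targetProgram ℓ ⨾ trailerProgram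
  reduceProgram ℓ = writeSamples ℓ ⨾ pour is-just O I [_] V none

  writeTime reduceTime : ℕ → ℕ → ℕ
  writeTime ℓ M = headerTime M + (loopTime (gateTime M) M + (1 + (targetTime ℓ M + trailerTime M)))
  reduceTime ℓ M = writeTime ℓ M + pourTime (writeTime ℓ M)

  reverse-++₅ : ∀ (xs₀ xs₁ xs₂ xs₃ xs₄ xs₅ : List Symbol) →
    reverse (xs₀ ++ xs₁ ++ xs₂ ++ xs₃ ++ xs₄ ++ xs₅)
      ≡ xs₅ ʳ++ xs₄ ʳ++ xs₃ ʳ++ xs₂ ʳ++ xs₁ ʳ++ xs₀ ʳ++ []
  reverse-++₅ xs₀ xs₁ xs₂ xs₃ xs₄ xs₅ = trans (List.++-ʳ++ xs₀)
    (trans (List.++-ʳ++ xs₁) (trans (List.++-ʳ++ xs₂) (trans (List.++-ʳ++ xs₃) (List.++-ʳ++ xs₄))))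

  -- The constants cover the encoded targets: the reciprocal takes 3 symbols for sign and numerator
  -- and at most one more than its denominator for the rest, and the target 2 takes 5 symbols.
  reduceProgram-runs : ∀ {M n k} ℓ (G : Gates n k) o .{{_ : ℕ.NonZero k}} →
    k ≤ M → 4 + (10 * k) ^ suc ℓ ≤ M → 5 ≤ M →
    ∃ λ s → (reduceProgram ℓ ⊢ stacks (encodeSubset ⁅ o ⁆ ++ encodeGates G) [] [] [] [] [] [] [] ⇒ s
              within reduceTime ℓ M)
          × lookup s I ≡ encodeUnary (suc k) ++ encodePoints (circuitSamples G o (reciprocal ((10 * k) ^ suc ℓ)))
  reduceProgram-runs {M} {n} {k} ℓ G o k≤ N≤ 5≤ =
    stacks (reverse outcome) [] a [] (ones k) [] [] w₂
    , subst (λ i → reduceProgram ℓ ⊢ stacks i [] [] [] [] [] [] [] ⇒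
          stacks (reverse outcome) [] a [] (ones k) [] [] w₂ within reduceTime ℓ M)
        (sym (List.++-assoc (bits ⁅ o ⁆) (♯ ∷ []) (encodeGates G)))
        (finish written)
    , trans (cong reverse outcome≡) (List.reverse-involutive word)
    where
    N = (10 * k) ^ suc ℓ
    w₀ = encodeℚ 0ℚ
    w₁ = encodeℚ (reciprocal N)
    w₂ = encodeℚ 2ℚ
    a = reverse (pad G ++ zeros n)
    R₀ = rowWord unitHead w₀ (codes ⁅ o ⁆)
    R₁ = rowWords unitHead w₀ [] (gateRows G)
    R₂ = literalWords zeroHead w₁ (pad G) (singletons (⊤ {n}))
    R₃ = rowWord unitHead w₂ (pad G ++ zeros n)

    outcome : List Symbol
    outcome = ♯ ∷ R₃ ʳ++ R₂ ʳ++ R₁ ʳ++ R₀ ʳ++ encodeUnary (suc k) ʳ++ []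

    word : List Symbol
    word = encodeUnary (suc k) ++ encodePoints (circuitSamples G o (reciprocal N))

    outcome≡ : outcome ≡ reverse word
    outcome≡ = sym (trans
      (cong (λ l → reverse (encodeUnary (suc k) ++ l)) (encodePoints-circuitSamples G o (reciprocal N)))
      (reverse-++₅ (encodeUnary (suc k)) R₀ R₁ R₂ R₃ (♯ ∷ [])))

    w₁≤ : length w₁ ≤ M
    w₁≤ = ℕ.≤-trans (ℕ.≤-reflexive (cong length (encodeℚ-reciprocal N {{ℕ.m^n≢0 (10 * k) (suc ℓ) {{ℕ.m*n≢0 10 k}}}})))
      (ℕ.≤-trans (s≤s (s≤s (s≤s (length-encodeℕᵇ N)))) N≤)

    written : writeSamples ℓ ⊢ stacks (bits ⁅ o ⁆ ++ ♯ ∷ encodeGates G) [] [] [] [] [] [] [] ⇒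
      stacks [] outcome a [] (ones k) [] [] w₂ within writeTime ℓ M
    written = headerProgram-runs ⁅ o ⁆ k≤ 4≤
      then weaken (loopTime-mono (ℕ.≤-refl {gateTime M}) k≤) (writeGates-runs w₀ [] G 4≤ k≤)
      then pop-runs
      then targetProgram-runs ℓ k k≤ 4≤ (ℕ.≤-trans (s≤s (ℕ.m≤n+m N 3)) N≤)
      then trailerProgram-runs {p = pad G} w₁≤ (ℕ.≤-trans (ℕ.≤-reflexive (length-pad G)) k≤) 5≤
      where
      4≤ : 4 ≤ M
      4≤ = ℕ.≤-trans (ℕ.n≤1+n 4) 5≤

    finish : writeSamples ℓ ⊢ stacks (bits ⁅ o ⁆ ++ ♯ ∷ encodeGates G) [] [] [] [] [] [] [] ⇒
        stacks [] outcome a [] (ones k) [] [] w₂ within writeTime ℓ M →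
      reduceProgram ℓ ⊢ stacks (bits ⁅ o ⁆ ++ ♯ ∷ encodeGates G) [] [] [] [] [] [] [] ⇒
        stacks (reverse outcome) [] a [] (ones k) [] [] w₂ within reduceTime ℓ M
    finish (t , r , t≤) = (t , r , t≤) then
      -- `O` starts empty, so the steps taken so far bound its length and thereby the cost of the
      -- final reversal.
      weaken (pourTime-mono (ℕ.≤-trans (length-lookup-runs r O) t≤))
        (drain-runs O I V (stacks [] [] a [] (ones k) [] [] w₂) {[_]} {none}
          (λ _ → short) (λ _ → short) outcome (List.concatMap-pure outcome) (concatMap-none outcome))

  -- Polynomial bounds

  -- The base `suc n` is positive, so raising the exponent never decreases the bound; this makes
  -- closure under sums immediate.
  Polynomial : (ℕ → ℕ) → Set
  Polynomial f = ∃₂ λ c e → ∀ n → f n ≤ c * suc n ^ e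

  poly-const : ∀ c → Polynomial (λ _ → c)
  poly-const c = c , 0 , λ _ → ℕ.≤-reflexive (sym (ℕ.*-identityʳ c))

  poly-id : Polynomial (λ n → n)
  poly-id = 1 , 1 , λ n → ℕ.≤-trans (ℕ.n≤1+n n)
    (ℕ.≤-reflexive (sym (trans (ℕ.*-identityˡ _) (ℕ.*-identityʳ (suc n)))))

  poly-+ : ∀ {f g} → Polynomial f → Polynomial g → Polynomial (λ n → f n + g n)
  poly-+ {f} {g} (c , d , f≤) (c′ , d′ , g≤) = c + c′ , d + d′ , λ n → begin
    f n + g n                                      ≤⟨ ℕ.+-mono-≤ (f≤ n) (g≤ n) ⟩
    c * suc n ^ d + c′ * suc n ^ d′                ≤⟨ ℕ.+-mono-≤
        (ℕ.*-monoʳ-≤ c (ℕ.^-monoʳ-≤ (suc n) (ℕ.m≤m+n d d′)))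
        (ℕ.*-monoʳ-≤ c′ (ℕ.^-monoʳ-≤ (suc n) (ℕ.m≤n+m d′ d))) ⟩
    c * suc n ^ (d + d′) + c′ * suc n ^ (d + d′)   ≡⟨ ℕ.*-distribʳ-+ (suc n ^ (d + d′)) c c′ ⟨
    (c + c′) * suc n ^ (d + d′)                    ∎
    where open ℕ.≤-Reasoning

  poly-* : ∀ {f g} → Polynomial f → Polynomial g → Polynomial (λ n → f n * g n)
  poly-* {f} {g} (c , d , f≤) (c′ , d′ , g≤) = c * c′ , d + d′ , λ n → begin
    f n * g n                                  ≤⟨ ℕ.*-mono-≤ (f≤ n) (g≤ n) ⟩
    (c * suc n ^ d) * (c′ * suc n ^ d′)        ≡⟨ ℕ.[m*n]*[o*p]≡[m*o]*[n*p] c (suc n ^ d) c′ (suc n ^ d′) ⟩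
    (c * c′) * (suc n ^ d * suc n ^ d′)        ≡⟨ cong ((c * c′) *_) (ℕ.^-distribˡ-+-* (suc n) d d′) ⟨
    (c * c′) * suc n ^ (d + d′)                ∎
    where open ℕ.≤-Reasoning

  poly-^ : ∀ {f} → Polynomial f → ∀ j → Polynomial (λ n → f n ^ j)
  poly-^ pf zero    = poly-const 1
  poly-^ pf (suc j) = poly-* pf (poly-^ pf j)

  poly-≤ : ∀ {f g} → (∀ n → f n ≤ g n) → Polynomial g → Polynomial f
  poly-≤ f≤g (c , d , g≤) = c , d , λ n → ℕ.≤-trans (f≤g n) (g≤ n)

  loopTime≡ : ∀ t n → loopTime t n ≡ n * suc t + 1
  loopTime≡ t zero    = refl
  loopTime≡ t (suc n) = trans (cong (λ m → suc (t + m)) (loopTime≡ t n))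
    (sym (ℕ.+-assoc (suc t) (n * suc t) 1))

  poly-loopTime : ∀ {f g} → Polynomial f → Polynomial g → Polynomial (λ n → loopTime (f n) (g n))
  poly-loopTime {f} {g} pf pg = poly-≤ (λ n → ℕ.≤-reflexive (loopTime≡ (f n) (g n)))
    (poly-+ (poly-* pg (poly-+ (poly-const 1) pf)) (poly-const 1))

  ^-distribʳ-* : ∀ m n j → (m * n) ^ j ≡ m ^ j * n ^ j
  ^-distribʳ-* m n zero    = refl
  ^-distribʳ-* m n (suc j) = trans (cong (m * n *_) (^-distribʳ-* m n j))
    (ℕ.[m*n]*[o*p]≡[m*o]*[n*p] m n (m ^ j) (n ^ j))

  -- For positive `n` the successor is at most `2 * n`, whence the factor `2 ^ d`; the additive
  -- constant covers `n = 0`.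
  Polynomial⇒bound : ∀ {f} → Polynomial f → ∃₂ λ c e → ∀ n → f n ≤ c * n ^ e + c
  Polynomial⇒bound {f} (c , d , f≤) = c * 2 ^ d , d , λ n → ℕ.≤-trans (f≤ n) (bound n)
    where
    open ℕ.≤-Reasoning

    bound : ∀ n → c * suc n ^ d ≤ c * 2 ^ d * n ^ d + c * 2 ^ d
    bound zero = begin
      c * 1 ^ d                             ≤⟨ ℕ.*-monoʳ-≤ c (ℕ.^-monoˡ-≤ d (s≤s z≤n)) ⟩
      c * 2 ^ d                             ≤⟨ ℕ.m≤n+m (c * 2 ^ d) _ ⟩
      c * 2 ^ d * 0 ^ d + c * 2 ^ d         ∎
    bound (suc n) = begin
      c * suc (suc n) ^ d                   ≤⟨ ℕ.*-monoʳ-≤ c (ℕ.^-monoˡ-≤ d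
          (s≤s (ℕ.≤-trans (ℕ.≤-reflexive (sym (ℕ.+-identityʳ (suc n)))) (ℕ.m≤n+m _ n)))) ⟩
      c * (2 * suc n) ^ d                   ≡⟨ cong (c *_) (^-distribʳ-* 2 (suc n) d) ⟩
      c * (2 ^ d * suc n ^ d)               ≡⟨ ℕ.*-assoc c (2 ^ d) (suc n ^ d) ⟨
      c * 2 ^ d * suc n ^ d                 ≤⟨ ℕ.m≤m+n _ (c * 2 ^ d) ⟩
      c * 2 ^ d * suc n ^ d + c * 2 ^ d     ∎

  module _ {m : ℕ → ℕ} (pm : Polynomial m) where

    poly-pourTime : Polynomial (λ n → pourTime (m n))
    poly-pourTime = poly-loopTime (poly-const 25) pm

    poly-pourTime₂ : Polynomial (λ n → pourTime₂ (m n))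
    poly-pourTime₂ = poly-+ poly-pourTime poly-pourTime

    poly-rowTime : Polynomial (λ n → rowTime (m n))
    poly-rowTime = poly-+ (poly-const 7) (poly-+ poly-pourTime₂ poly-pourTime₂)

    poly-stepTime : Polynomial (λ n → stepTime (m n))
    poly-stepTime = poly-+ (poly-const 8) (poly-+
      (poly-+ poly-pourTime₂ (poly-+ (poly-const 7) (poly-+ poly-pourTime (poly-+ poly-pourTime poly-pourTime₂))))
      (poly-const 1))

    poly-singletons : Polynomial (λ n → loopTime (stepTime (m n)) (m n))
    poly-singletons = poly-loopTime poly-stepTime pm

    poly-gateTime : Polynomial (λ n → gateTime (m n))
    poly-gateTime = poly-+ (poly-const 1) (poly-+ (poly-const 1) (poly-+
      (poly-+ (poly-const 2) (poly-+ poly-singletons (poly-+ poly-pourTime poly-rowTime)))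
      (poly-+ (poly-const 1) (poly-+ poly-pourTime (poly-const 2)))))

    poly-multiplyTime : Polynomial (λ n → multiplyTime (m n))
    poly-multiplyTime = poly-+ (poly-loopTime (poly-+ (poly-const 1) poly-pourTime₂) pm) poly-pourTime

    poly-powerTime : ∀ j → Polynomial (λ n → powerTime j (m n))
    poly-powerTime zero    = poly-const 1
    poly-powerTime (suc j) = poly-+ poly-multiplyTime (poly-powerTime j)

    poly-incrementTime : Polynomial (λ n → incrementTime (m n))
    poly-incrementTime = poly-+ poly-pourTime (poly-+ (poly-const 3) poly-pourTime)

    poly-targetTime : ∀ ℓ → Polynomial (λ n → targetTime ℓ (m n))
    poly-targetTime ℓ = poly-+ poly-pourTime (poly-+ (poly-const 1) (poly-+ (poly-powerTime (suc ℓ))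
      (poly-+ (poly-const 1) (poly-+ (poly-loopTime (poly-+ (poly-const 1) poly-incrementTime) pm) (poly-const 4)))))

    poly-headerTime : Polynomial (λ n → headerTime (m n))
    poly-headerTime = poly-+ (poly-const 5) (poly-+ poly-pourTime (poly-+ (poly-const 1) (poly-+ (poly-const 1)
      (poly-+ poly-pourTime (poly-+ poly-pourTime (poly-+ (poly-const 1) (poly-+ poly-rowTime poly-pourTime)))))))

    poly-trailerTime : Polynomial (λ n → trailerTime (m n))
    poly-trailerTime = poly-+ poly-singletons (poly-+ (poly-const 1) (poly-+ poly-pourTime
      (poly-+ (poly-const 6) (poly-+ poly-rowTime (poly-const 1)))))

    poly-writeTime : ∀ ℓ → Polynomial (λ n → writeTime ℓ (m n))
    poly-writeTime ℓ = poly-+ poly-headerTime (poly-+ (poly-loopTime poly-gateTime pm)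
      (poly-+ (poly-const 1) (poly-+ (poly-targetTime ℓ) poly-trailerTime)))

  -- The final pour handles a stack bounded only by the preceding running time, so `poly-pourTime`
  -- is instantiated at `writeTime`. This is one use of having the bounds for an arbitrary
  -- polynomial `m`.
  poly-reduceTime : ∀ {m} → Polynomial m → ∀ ℓ → Polynomial (λ n → reduceTime ℓ (m n))
  poly-reduceTime pm ℓ = poly-+ (poly-writeTime pm ℓ) (poly-pourTime (poly-writeTime pm ℓ))

  -- A common value of `M` for input length `L`: it dominates the number of wires, the encoded
  -- targets and the power computed in unary.
  budget : ℕ → ℕ → ℕ
  budget ℓ L = L + (5 + (10 * L) ^ suc ℓ)

  abstract
    reduceTime-bound : ∀ ℓ → ∃₂ λ c e → ∀ L → reduceTime ℓ (budget ℓ L) ≤ c * L ^ e + c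
    reduceTime-bound ℓ = Polynomial⇒bound (poly-reduceTime (poly-+ poly-id
      (poly-+ (poly-const 5) (poly-^ (poly-* (poly-const 10) poly-id) (suc ℓ)))) ℓ)

  -- The subset marking the output spends one symbol on every wire.
  size≤length : ∀ C → size C ≤ length (encodeCircuit C)
  size≤length C = begin
    size C                                 ≡⟨ length-bits s ⟨
    length (bits s)                        ≤⟨ ℕ.m≤m+n (length (bits s)) (length (♯ ∷ w)) ⟩
    length (bits s) + length (♯ ∷ w)       ≡⟨ List.length-++ (bits s) ⟨
    length (bits s ++ ♯ ∷ w)               ≡⟨ cong length (List.++-assoc (bits s) (♯ ∷ []) w) ⟨
    length (encodeCircuit C)               ∎
    where
    open ℕ.≤-Reasoning
    s = ⁅ output C ⁆
    w = encodeGates (gates C)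

  reduceProgram-withinBudget : ∀ ℓ C → ∃ λ s →
    (reduceProgram ℓ ⊢ encodeCircuit C ∷ Vec.replicate 7 [] ⇒ s
       within reduceTime ℓ (budget ℓ (length (encodeCircuit C))))
    × lookup s I ≡ encodeSamples (reduction ℓ C)
  reduceProgram-withinBudget ℓ C =
    reduceProgram-runs {budget ℓ L} ℓ (gates C) (output C) {{Fin.nonZeroIndex (output C)}}
      (ℕ.≤-trans (size≤length C) (ℕ.m≤m+n L N))
      (ℕ.≤-trans (ℕ.+-mono-≤ (ℕ.n≤1+n 4) (ℕ.^-monoˡ-≤ (suc ℓ) (ℕ.*-monoʳ-≤ 10 (size≤length C))))
        (ℕ.m≤n+m N L))
      (ℕ.≤-trans (ℕ.m≤m+n 5 ((10 * L) ^ suc ℓ)) (ℕ.m≤n+m N L))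
    where
    L = length (encodeCircuit C)
    N = 5 + (10 * L) ^ suc ℓ

  reduction-polyTime : ∀ ℓ → PolyTimeOn encodeCircuit encodeSamples (λ C → depth C ≡ ℓ) (reduction ℓ)
  reduction-polyTime ℓ with reduceTime-bound ℓ
  ... | c , e , bound = 7 , reduceProgram ℓ , c , e , λ C _ →
    let s , (t , r , t≤) , output≡ = reduceProgram-withinBudget ℓ C
    in t , s , r , output≡ , ℕ.≤-trans t≤ (bound (length (encodeCircuit C)))

open import Data.Integer.Base using (+_)
open import Data.Nat.Base using (ℕ; _>_; _+_; _*_; _^_)
open import Data.Product.Base using (∃; _×_)
open import Data.Rational.Base using (_/_)
open import Relation.Binary.PropositionalEquality using (_≡_)

theorem6 : ∀ (ℓ : ℕ) → ℓ > 0 →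
    ∃ λ (reduce : Circuit → Samples) →
      PolyTimeOn encodeCircuit encodeSamples (λ C → depth C ≡ ℓ) reduce
      × (∀ C → depth C ≡ ℓ →
           IsMin (error (reduce C))
                 (fromℚ (_/_ (+ opt C) ((10 * size C) ^ (2 * ℓ + 2)) {{scale≢0 C ℓ}})))
theorem6 ℓ _ =
  Optimum.reduction ℓ , Machine.reduction-polyTime ℓ , λ C _ → Optimum.reduction-isMin ℓ C
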